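{- Let $A$ be a finite set of $n:=|A|\ge 3$ integers with $\min(A)=0$ and $\gcd(A)=1$, and let $l:=\max(A)$. Let $\mathcal{E}$ be the exceptional set of $A$ and $\mathcal{E}'$ the exceptional set of $l-A=\{l-a\colon a\in A\}$. Put $M:=l-n+2$. Then for every integer $m\ge M$, $$ mA=[0,ml]\setminus\big(\mathcal{E}\cup(ml-\mathcal{E}')\big). $$ Moreover, for every integer $m\ge M$ the interval $[\max(\mathcal{E})+1,\ \min(ml-\mathcal{E}')-1]$ is nonempty and contained in $mA$; indeed, writing $l-1=k(n-2)+r$ with integers $k\ge 1$ and $r\in[0,n-3]$, we have $$ \min(ml-\mathcal{E}')-\max(\mathcal{E})\ \ge\ (m-M+1)l+\Delta, $$ where $$ \Delta=l(k-1)(n-3)+rk(n-3)+r^2+k+1\ \ge 2. $$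
   Context: For a finite set $A$ of integers and a positive integer $m$, $mA:=\{a_1+\dots+a_m\colon a_1,\dots,a_m\in A\}$ is the $m$-fold sumset (summands not necessarily distinct). For integers $x\le y$, $[x,y]$ denotes the set of integers $z$ with $x\le z\le y$. For a set $B$ of integers and an integer $c$, $c-B:=\{c-b\colon b\in B\}$. The exceptional set $\mathcal{E}(B)$ of a finite set $B$ of nonnegative integers with $\min(B)=0$ and $\gcd(B)=1$ is the set of all positive integers that cannot be written as a nonnegative integer linear combination of elements of $B$ (the complement in the positive integers of the additive semigroup generated by $B$); it is finite. Convention: if $\mathcal{E}=\emptyset$ then $\max(\mathcal{E})=-1$, and similarly $\max(\mathcal{E}')=-1$ if $\mathcal{E}'=\emptyset$, so that $\min(ml-\mathcal{E}')=ml-\max(\mathcal{E}')$ in all cases. -}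

module Defs where

open import Data.Nat using (ℕ; zero; suc; _+_; _*_; _∸_; _≤_; _<_)
open import Data.Nat.GCD using (gcd)
open import Data.Integer as ℤ using (ℤ; +_; -[1+_])
open import Data.List using (List; foldr; map; length)
open import Data.Nat.ListAction using (sum)
open import Data.List.Membership.Propositional using (_∈_)
open import Data.List.Relation.Unary.All using (All)
open import Data.Product using (Σ; _×_)
open import Data.Sum using (_⊎_)
open import Relation.Nullary using (¬_)
open import Relation.Binary.PropositionalEquality using (_≡_)

-- A finite set of (nonnegative) integers is represented by a duplicate-free
-- list of naturals (see Statement: Unique A).

gcdList : List ℕ → ℕ
gcdList = foldr gcd 0

reflectSet : ℕ → List ℕ → List ℕ
reflectSet c B = map (c ∸_) B

InSumset : ℕ → List ℕ → ℕ → Set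
InSumset m A x = Σ (List ℕ) λ xs →
  length xs ≡ m × All (_∈ A) xs × sum xs ≡ x

Representable : List ℕ → ℕ → Set
Representable B x = Σ (List ℕ) λ xs → All (_∈ B) xs × sum xs ≡ x

InExc : List ℕ → ℕ → Set
InExc B x = (0 < x) × ¬ Representable B x

-- e is max(E(B)), with the convention max ∅ = -1
IsMaxExc : List ℕ → ℤ → Set
IsMaxExc B e =
  ((∀ x → ¬ InExc B x) × e ≡ -[1+ 0 ])
  ⊎ (Σ ℕ λ x → InExc B x × e ≡ + x × (∀ y → InExc B y → y ≤ x))

{-# OPTIONS --safe #-}
-- Structure. Comparing representations of x + j l by m + i + j elements of A reduces the claim to one step: if
-- x and x + l both lie in (m + 1) A and m ≥ M, then x ∈ m A. Otherwise no representation of x uses 0 and none of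
-- x + l uses l. Then the residues modulo l of A, of the partial sums of the representation of x, and of those
-- partial sums of the other one that match none of the former are all distinct, and there are more than l of them.
--
-- Block. For a residue g let t(g) l be the least element of ⟨A⟩ in the class g plus the least element of
-- ⟨l - A⟩ in the class -g, and let N(h) be the number of g with t(g) ≤ h. Then N(h + 1) ≥ min(l, N(h) + n - 2).
-- This is Kneser's theorem for {t ≤ h} + A when the sumset is aperiodic; when it is periodic with period H, a
-- coset of H just outside it contains enough further elements of {t ≤ h + 1}. For large m, m A consists of
-- N(0) + ... + N(m) elements, while at most half of the integers up to a gap of ⟨A⟩ lie in ⟨A⟩, and likewise for
-- ⟨l - A⟩; this bounds max(E) + max(E'), exactly by the stated quantity.

module Submission where

open import Defs
open import Algebra.Bundles using (AbelianGroup)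
open import Algebra.Structures using (IsAbelianGroup)
open import Data.Empty using (⊥; ⊥-elim)
open import Data.Fin as Fin using (Fin; zero; suc; toℕ)
open import Data.Fin.Properties using (injective⇒≤; toℕ-fromℕ<; toℕ-injective; toℕ<n)
open import Data.Integer as ℤ using (ℤ)
import Data.Integer.Properties as ℤ
import Data.Integer.Tactic.RingSolver as ℤSolver
open import Data.List
  using (List; []; _∷_; length; lookup; map; filter; _++_; cartesianProduct; take; drop; upTo; applyUpTo; allFin)
open import Data.List.Properties
  using (length-++; length-map; length-upTo; length-applyUpTo; length-tabulate; length-take; length-drop; take++drop≡id; take-all)
open import Data.List.Membership.Propositional using (_∈_; find; lose)
open import Data.List.Membership.Propositional.Properties
  using (∈-lookup; ∈-map⁺; ∈-map⁻; ∈-++⁺ˡ; ∈-++⁺ʳ; ∈-++⁻; ∈-filter⁺; ∈-filter⁻; ∈-cartesianProduct⁺; ∈-cartesianProduct⁻;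
         ∈-allFin; ∈-upTo⁺; ∈-upTo⁻; ∈-applyUpTo⁻)
open import Data.List.Relation.Unary.All as All using (All; []; _∷_)
import Data.List.Relation.Unary.All.Properties as All
open import Data.List.Relation.Unary.AllPairs using ([]; _∷_)
open import Data.List.Relation.Unary.Any using (Any; here; there; any?; index)
open import Data.List.Relation.Unary.Any.Properties using (lookup-index)
open import Data.List.Relation.Unary.Unique.Propositional using (Unique)
open import Data.List.Relation.Unary.Unique.Propositional.Properties
  using (map⁺; ++⁺; cartesianProduct⁺; filter⁺; allFin⁺; upTo⁺; applyUpTo⁺₁)
open import Data.Nat as ℕ
  using (ℕ; zero; suc; NonZero; _+_; _*_; _∸_; _≤_; _<_; _/_; _%_; z≤n; s≤s; z<s)
open import Data.Nat.DivMod
  using (_mod_; m≡m%n+[m/n]*n; m%n<n; m%n≤m; m<n⇒m%n≡m; %-distribˡ-+; [m+n]%n≡m%n; [m+kn]%n≡m%n; /-monoˡ-≤; m≥n⇒m/n>0)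
open import Data.Nat.ListAction using (sum)
open import Data.Nat.ListAction.Properties using (sum-++)
open import Data.Nat.Properties
import Data.List.Extrema ≤-totalOrder as Extrema
open import Data.Nat.Tactic.RingSolver using (solve-∀)
open import Data.Product using (Σ; ∃; ∃₂; _×_; _,_; proj₁; proj₂)
open import Data.Sum using (_⊎_; inj₁; inj₂; [_,_]′)
open import Data.Sum.Properties using (inj₁-injective; inj₂-injective)
open import Function using (id; _∘_; case_of_)
open import Function.Bundles using (_⇔_; mk⇔; Equivalence)
open import Relation.Binary.PropositionalEquality
open import Relation.Nullary
  using (¬_; Dec; yes; no; ¬?; _×-dec_; _⊎-dec_; _→-dec_; map′; contradiction; decidable-stable)
open import Relation.Unary using (Decidable)

-- Counting

-- Membership of x + j l in (m + i + j) A is monotone in i and in j. It holds for j = 0 and large i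
-- if x lies in ⟨A⟩, and for i = 0 and large j if m l - x lies in ⟨l - A⟩; the one-step claim
-- carries it from these two axes back to the origin. Within that step the residues need not be
-- distinct for an arbitrary choice of representations: a partial sum may be congruent to an element
-- of A without shortening anything. It then gives a representation of the same length with fewer
-- terms other than 0 and l, so the argument descends on the number of such terms. In the growth of
-- N the obstacle is a period H of the sumset: Kneser's bound then leaves out as many elements as A
-- has residues in one coset of H, and all but one of them must be recovered without going up a
-- further level. A maximal Apéry element over a coset does this. The counting is done on the
-- right-hand side of the asserted equation, described by Apéry elements, so the bound on the gaps
-- is independent of the exchange argument.

lookup-unique : {A : Set} {xs : List A} → Unique xs → ∀ i j → lookup xs i ≡ lookup xs j → i ≡ j
lookup-unique (_ ∷ u) zero zero eq = refl
lookup-unique {xs = x ∷ xs} (p ∷ u) zero (suc j) eq = ⊥-elim (All.lookup p (∈-lookup j) eq)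
lookup-unique (p ∷ u) (suc i) zero eq = ⊥-elim (All.lookup p (∈-lookup i) (sym eq))
lookup-unique (p ∷ u) (suc i) (suc j) eq = cong suc (lookup-unique u i j eq)

length-inj : {A B : Set} {xs : List A} {ys : List B} → Unique xs → (f : A → B) →
  (∀ {x} → x ∈ xs → f x ∈ ys) → (∀ {x y} → x ∈ xs → y ∈ xs → f x ≡ f y → x ≡ y) →
  length xs ≤ length ys
length-inj {xs = xs} {ys} u f into inj = injective⇒≤ {f = pos} pos-inj
  where
  pos : Fin (length xs) → Fin (length ys)
  pos i = index (into (∈-lookup {xs = xs} i))
  at : ∀ i → f (lookup xs i) ≡ lookup ys (pos i)
  at i = lookup-index (into (∈-lookup {xs = xs} i))
  pos-inj : ∀ {i j} → pos i ≡ pos j → i ≡ j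
  pos-inj {i} {j} eq = lookup-unique u i j
    (inj (∈-lookup i) (∈-lookup j) (trans (at i) (trans (cong (lookup ys) eq) (sym (at j)))))

length-inj₂ : {A B C : Set} {xs : List A} {ys : List B} {zs : List C} → Unique xs → Unique ys →
  (f : A → C) (g : B → C) →
  (∀ {x} → x ∈ xs → f x ∈ zs) → (∀ {y} → y ∈ ys → g y ∈ zs) →
  (∀ {x x′} → x ∈ xs → x′ ∈ xs → f x ≡ f x′ → x ≡ x′) →
  (∀ {y y′} → y ∈ ys → y′ ∈ ys → g y ≡ g y′ → y ≡ y′) →
  (∀ {x y} → x ∈ xs → y ∈ ys → ¬ f x ≡ g y) →
  length xs + length ys ≤ length zs
length-inj₂ {A = A} {B} {C} {xs} {ys} {zs} ux uy f g fz gz fi gi dis =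
  subst (_≤ length zs)
    (trans (length-++ (map inj₁ xs)) (cong₂ _+_ (length-map inj₁ xs) (length-map inj₂ ys)))
    (length-inj uniq [ f , g ]′ into inj)
  where
  both : List (A ⊎ B)
  both = map inj₁ xs ++ map inj₂ ys
  uniq : Unique both
  uniq = ++⁺ (map⁺ inj₁-injective ux) (map⁺ inj₂-injective uy)
    λ (p , q) → case trans (sym (proj₂ (proj₂ (∈-map⁻ inj₁ p)))) (proj₂ (proj₂ (∈-map⁻ inj₂ q))) of λ ()
  left : ∀ {x} → inj₁ x ∈ both → x ∈ xs
  left p with ∈-++⁻ (map inj₁ xs) p
  ... | inj₁ q with _ , r , refl ← ∈-map⁻ inj₁ q = r
  ... | inj₂ q with _ , _ , () ← ∈-map⁻ inj₂ q
  right : ∀ {y} → inj₂ y ∈ both → y ∈ ys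
  right p with ∈-++⁻ (map inj₁ xs) p
  ... | inj₁ q with _ , _ , () ← ∈-map⁻ inj₁ q
  ... | inj₂ q with _ , r , refl ← ∈-map⁻ inj₂ q = r
  into : ∀ {v} → v ∈ both → [ f , g ]′ v ∈ zs
  into {inj₁ x} p = fz (left p)
  into {inj₂ y} p = gz (right p)
  inj : ∀ {v w} → v ∈ both → w ∈ both → [ f , g ]′ v ≡ [ f , g ]′ w → v ≡ w
  inj {inj₁ x} {inj₁ y} p q eq = cong inj₁ (fi (left p) (left q) eq)
  inj {inj₁ x} {inj₂ y} p q eq = ⊥-elim (dis (left p) (right q) eq)
  inj {inj₂ x} {inj₁ y} p q eq = ⊥-elim (dis (left q) (right p) (sym eq))
  inj {inj₂ x} {inj₂ y} p q eq = cong inj₂ (gi (right p) (right q) eq)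

length-× : {A B : Set} (xs : List A) (ys : List B) → length (cartesianProduct xs ys) ≡ length xs * length ys
length-× [] ys = refl
length-× (x ∷ xs) ys =
  trans (length-++ (map (x ,_) ys)) (cong₂ _+_ (length-map (x ,_) ys) (length-× xs ys))

length-inj-× : {A B C D : Set} {xs : List A} {ys : List B} {zs : List C} {ws : List D} →
  Unique xs → Unique ys → (f : A × B → C × D) →
  (∀ {x y} → x ∈ xs → y ∈ ys → proj₁ (f (x , y)) ∈ zs × proj₂ (f (x , y)) ∈ ws) →
  (∀ {x y x′ y′} → x ∈ xs → y ∈ ys → x′ ∈ xs → y′ ∈ ys → f (x , y) ≡ f (x′ , y′) → (x , y) ≡ (x′ , y′)) →
  length xs * length ys ≤ length zs * length ws
length-inj-× {xs = xs} {ys} {zs} {ws} ux uy f into inj =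
  subst₂ _≤_ (length-× xs ys) (length-× zs ws)
    (length-inj (cartesianProduct⁺ ux uy) f
      (λ p → let x∈ , y∈ = ∈-cartesianProduct⁻ xs ys p
                 z∈ , w∈ = into x∈ y∈
             in ∈-cartesianProduct⁺ z∈ w∈)
      (λ p q → let x∈ , y∈ = ∈-cartesianProduct⁻ xs ys p
                   x′∈ , y′∈ = ∈-cartesianProduct⁻ xs ys q
               in inj x∈ y∈ x′∈ y′∈))

length-remove : (a : ℕ) {xs : List ℕ} → Unique xs → length xs ≤ suc (length (filter (λ x → ¬? (x ℕ.≟ a)) xs))
length-remove a {xs} u = length-inj {ys = a ∷ filter (λ x → ¬? (x ℕ.≟ a)) xs} u (λ x → x) into (λ _ _ eq → eq)
  where
  into : ∀ {x} → x ∈ xs → x ∈ a ∷ filter (λ x → ¬? (x ℕ.≟ a)) xs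
  into {x} p with x ℕ.≟ a
  ... | yes refl = here refl
  ... | no x≢a   = there (∈-filter⁺ (λ x → ¬? (x ℕ.≟ a)) p x≢a)

-- A linear consequence of a ≤ b, read off from an identity with slack s.
slack-≤ : ∀ {a b x y} s → a ≤ b → x + b + s ≡ y + a → x ≤ y
slack-≤ {a} {b} {x} {y} s a≤b eq = +-cancelʳ-≤ b x y
  (≤-trans (m≤m+n _ s) (≤-trans (≤-reflexive eq) (+-monoʳ-≤ y a≤b)))

-- Kneser's theorem in a finite abelian group

-- Put σ = η + y and ρ′ = η + x. Each strict size condition, multiplied by η and combined with its
-- area bound, becomes ρ y + η ≤ η x and α x + η ≤ η y respectively; with η ≤ ρ and η ≤ α this
-- closes the cycle ρ y < α x < ρ y.
grid-arith : ∀ ρ ρ′ σ α η d d′ →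
  ρ * σ ≤ η * d → α * ρ′ ≤ η * d′ →
  suc (d + η) ≤ ρ + ρ′ → suc (d′ + η) ≤ σ + α →
  η ≤ ρ → η ≤ σ → η ≤ α → 1 ≤ η → ⊥
grid-arith ρ ρ′ σ α η d d′ p q p′ q′ η≤ρ η≤σ η≤α 1≤η
  with y , refl ← m≤n⇒∃[o]m+o≡n η≤σ
  = final (m≤n⇒∃[o]m+o≡n η≤ρ′)
  where
  e₁ : ∀ ρ ρ′ y η d → η * η + (η * d + η * (ρ + ρ′)) + (ρ * y + η)
    ≡ η * ρ′ + (ρ * (η + y) + η * suc (d + η))
  e₁ = solve-∀
  -- The same inequality with ρ y + η given away as slack; x cannot be introduced before this is
  -- known.
  η≤ρ′ : η ≤ ρ′
  η≤ρ′ = *-cancelˡ-≤ η ⦃ ℕ.>-nonZero 1≤η ⦄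
    (slack-≤ (ρ * y + η) (+-mono-≤ p (*-monoʳ-≤ η p′)) (e₁ ρ ρ′ y η d))
  e₂ : ∀ ρ x y η d → ρ * y + η + (η * d + η * (ρ + (η + x))) + 0
    ≡ η * x + (ρ * (η + y) + η * suc (d + η))
  e₂ = solve-∀
  e₃ : ∀ α x y η d′ → α * x + η + (η * d′ + η * (η + y + α)) + 0
    ≡ η * y + (α * (η + x) + η * suc (d′ + η))
  e₃ = solve-∀
  final : ∃ (λ x → η + x ≡ ρ′) → ⊥
  final (x , refl) = <-irrefl refl (begin-strict
    ρ * y        <⟨ m<m+n _ 1≤η ⟩
    ρ * y + η  ≤⟨ slack-≤ 0 (+-mono-≤ p (*-monoʳ-≤ η p′)) (e₂ ρ x y η d) ⟩
    η * x        ≤⟨ *-monoˡ-≤ x η≤α ⟩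
    α * x        ≤⟨ m≤m+n _ η ⟩
    α * x + η  ≤⟨ slack-≤ 0 (+-mono-≤ q (*-monoʳ-≤ η q′)) (e₃ α x y η d′) ⟩
    η * y        ≤⟨ *-monoˡ-≤ y η≤ρ ⟩
    ρ * y ∎)
    where open ≤-Reasoning

module FiniteGroup {G : Set} {_⊞_ : G → G → G} {0# : G} { ⊟_ : G → G}
  (isAbelianGroup : IsAbelianGroup _≡_ _⊞_ 0# ⊟_)
  (elems : List G) (complete : ∀ g → g ∈ elems) (unique : Unique elems) where

  open IsAbelianGroup isAbelianGroup
    using () renaming (assoc to ⊞-assoc; comm to ⊞-comm; identityʳ to ⊞-identityʳ; identityˡ to ⊞-identityˡ; inverseʳ to ⊞-inverseʳ)
  open IsAbelianGroup isAbelianGroup public using (_-_)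

  private
    group : AbelianGroup _ _
    group = record { isAbelianGroup = isAbelianGroup }
  open import Algebra.Properties.AbelianGroup group
    using (⁻¹-involutive; ⁻¹-∙-comm; ε⁻¹≈ε; ∙-cancelˡ; ∙-cancelʳ; //-rightDividesˡ; //-rightDividesʳ)

  sub-add : ∀ x y → (x - y) ⊞ y ≡ x
  sub-add x y = //-rightDividesˡ y x
  add-sub : ∀ x y → (x ⊞ y) - y ≡ x
  add-sub x y = //-rightDividesʳ y x
  add-sub′ : ∀ x y → (x ⊞ y) - x ≡ y
  add-sub′ x y = trans (cong (_- x) (⊞-comm x y)) (add-sub y x)
  sub-neg : ∀ x y → x - (⊟ y) ≡ x ⊞ y
  sub-neg x y = cong (x ⊞_) (⁻¹-involutive y)
  sub-+ : ∀ x y z → x - (y ⊞ z) ≡ (x - y) - z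
  sub-+ x y z = trans (cong (x ⊞_) (sym (⁻¹-∙-comm y z))) (sym (⊞-assoc x (⊟ y) (⊟ z)))
  sub-sub : ∀ x y → x - (x - y) ≡ y
  sub-sub x y = trans (sub-+ x x (⊟ y)) (trans (sub-neg (x - x) y) (trans (cong (_⊞ y) (⊞-inverseʳ x)) (⊞-identityˡ y)))
  telescope : ∀ x y z → (x - y) ⊞ (y - z) ≡ x - z
  telescope x y z = trans (sym (⊞-assoc (x - y) y (⊟ z))) (cong (_- z) (sub-add x y))
  swapʳ : ∀ x y z → (x ⊞ y) ⊞ z ≡ (x ⊞ z) ⊞ y
  swapʳ x y z = trans (⊞-assoc x y z) (trans (cong (x ⊞_) (⊞-comm y z)) (sym (⊞-assoc x z y)))

  record Subset : Set₁ where
    field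
      mem  : G → Set
      mem? : Decidable mem
  open Subset

  infix 4 _∋_ _⊆_
  _∋_ : Subset → G → Set
  X ∋ g = mem X g

  _⊆_ : Subset → Subset → Set
  X ⊆ Y = ∀ {g} → X ∋ g → Y ∋ g

  any-G? : {P : G → Set} → Decidable P → Dec (∃ P)
  any-G? P? = map′ (λ p → let g , _ , q = find p in g , q) (λ (g , q) → lose (complete g) q) (any? P? elems)

  all-G? : {P : G → Set} → Decidable P → Dec (∀ g → P g)
  all-G? P? = map′ (λ ¬∃ g → decidable-stable (P? g) (λ ¬p → ¬∃ (g , ¬p))) (λ all (g , ¬p) → ¬p (all g))
    (¬? (any-G? (¬? ∘ P?)))

  members : Subset → List G
  members X = filter (mem? X) elems

  members-unique : ∀ X → Unique (members X)
  members-unique X = filter⁺ (mem? X) unique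

  ∈-members : ∀ X {g} → X ∋ g → g ∈ members X
  ∈-members X = ∈-filter⁺ (mem? X) (complete _)

  members-∋ : ∀ X {g} → g ∈ members X → X ∋ g
  members-∋ X p = proj₂ (∈-filter⁻ (mem? X) {xs = elems} p)

  card : Subset → ℕ
  card X = length (members X)

  card-inj : ∀ X Y (f : G → G) → (∀ {g} → X ∋ g → Y ∋ f g) →
    (∀ {g h} → X ∋ g → X ∋ h → f g ≡ f h → g ≡ h) → card X ≤ card Y
  card-inj X Y f into inj = length-inj (members-unique X) f
    (∈-members Y ∘ into ∘ members-∋ X) (λ p q → inj (members-∋ X p) (members-∋ X q))

  card-inj₂ : ∀ X Y Z (f g : G → G) → (∀ {x} → X ∋ x → Z ∋ f x) → (∀ {y} → Y ∋ y → Z ∋ g y) →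
    (∀ {x x′} → X ∋ x → X ∋ x′ → f x ≡ f x′ → x ≡ x′) →
    (∀ {y y′} → Y ∋ y → Y ∋ y′ → g y ≡ g y′ → y ≡ y′) →
    (∀ {x y} → X ∋ x → Y ∋ y → ¬ f x ≡ g y) → card X + card Y ≤ card Z
  card-inj₂ X Y Z f g fz gz fi gi dis = length-inj₂ (members-unique X) (members-unique Y) f g
    (∈-members Z ∘ fz ∘ members-∋ X) (∈-members Z ∘ gz ∘ members-∋ Y)
    (λ p q → fi (members-∋ X p) (members-∋ X q)) (λ p q → gi (members-∋ Y p) (members-∋ Y q))
    (λ p q → dis (members-∋ X p) (members-∋ Y q))

  card-⊆ : ∀ X Y → X ⊆ Y → card X ≤ card Y
  card-⊆ X Y X⊆Y = card-inj X Y id X⊆Y (λ _ _ eq → eq)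

  card-disjoint : ∀ X Y Z → X ⊆ Z → Y ⊆ Z → (∀ {g} → X ∋ g → ¬ Y ∋ g) → card X + card Y ≤ card Z
  card-disjoint X Y Z X⊆Z Y⊆Z dis = card-inj₂ X Y Z id id X⊆Z Y⊆Z (λ _ _ eq → eq) (λ _ _ eq → eq)
    (λ { p q refl → dis p q })

  card-cover : ∀ X Y Z → (∀ {g} → X ∋ g → Y ∋ g ⊎ Z ∋ g) → card X ≤ card Y + card Z
  card-cover X Y Z cover = subst (card X ≤_) (length-++ (members Y))
    (length-inj (members-unique X) id (into ∘ cover ∘ members-∋ X) (λ _ _ eq → eq))
    where
    into : ∀ {g} → Y ∋ g ⊎ Z ∋ g → g ∈ members Y ++ members Z
    into (inj₁ p) = ∈-++⁺ˡ (∈-members Y p)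
    into (inj₂ p) = ∈-++⁺ʳ (members Y) (∈-members Z p)

  1≤card : ∀ X {g} → X ∋ g → 1 ≤ card X
  1≤card X {g} p = length-inj {xs = g ∷ []} ([] ∷ []) id
    (λ { (here refl) → ∈-members X p }) (λ _ _ eq → eq)

  card-⊂ : ∀ X Y → X ⊆ Y → ∀ {g} → Y ∋ g → ¬ X ∋ g → card X < card Y
  card-⊂ X Y X⊆Y {g} p ¬p = subst (_≤ card Y) (+-comm (card X) 1)
    (length-inj₂ {ys = g ∷ []} (members-unique X) ([] ∷ []) id id
      (∈-members Y ∘ X⊆Y ∘ members-∋ X) (λ { (here refl) → ∈-members Y p })
      (λ _ _ eq → eq) (λ _ _ eq → eq) (λ { q (here refl) refl → ¬p (members-∋ X q) }))

  infixl 6 _∪_ _∖_ _⊕_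
  infixl 7 _∩_
  _∪_ _∩_ _∖_ _⊕_ : Subset → Subset → Subset
  X ∪ Y = record { mem = λ g → X ∋ g ⊎ Y ∋ g ; mem? = λ g → mem? X g ⊎-dec mem? Y g }
  X ∩ Y = record { mem = λ g → X ∋ g × Y ∋ g ; mem? = λ g → mem? X g ×-dec mem? Y g }
  X ∖ Y = record { mem = λ g → X ∋ g × ¬ Y ∋ g ; mem? = λ g → mem? X g ×-dec ¬? (mem? Y g) }
  X ⊕ Y = record
    { mem  = λ g → ∃ λ x → X ∋ x × Y ∋ (g - x)
    ; mem? = λ g → any-G? (λ x → mem? X x ×-dec mem? Y (g - x)) }

  -- The translate X - t, so that X + t is `shift (⊟ t) X`.
  shift : G → Subset → Subset
  shift t X = record { mem = λ g → X ∋ (g ⊞ t) ; mem? = λ g → mem? X (g ⊞ t) }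

  ⊕-intro : ∀ X Y {x y} → X ∋ x → Y ∋ y → X ⊕ Y ∋ x ⊞ y
  ⊕-intro X Y {x} {y} p q = x , p , subst (Y ∋_) (sym (add-sub′ x y)) q

  card-shift : ∀ t X → card X ≤ card (shift t X)
  card-shift t X = card-inj X (shift t X) (_- t) (λ {g} → subst (X ∋_) (sym (sub-add g t)))
    (λ {g} {h} _ _ → ∙-cancelʳ (⊟ t) g h)

  stab : Subset → Subset
  stab X = record
    { mem  = λ h → ∀ g → (X ∋ g → X ∋ g ⊞ h) × (X ∋ g → X ∋ g - h)
    ; mem? = λ h → all-G? λ g → (mem? X g →-dec mem? X (g ⊞ h)) ×-dec (mem? X g →-dec mem? X (g - h)) }

  record IsSubgroup (H : Subset) : Set where
    field
      has-0  : H ∋ 0#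
      closed : ∀ {g h} → H ∋ g → H ∋ h → H ∋ g ⊞ h
      has--  : ∀ {g} → H ∋ g → H ∋ ⊟ g

  stab-isSubgroup : ∀ X → IsSubgroup (stab X)
  stab-isSubgroup X = record
    { has-0  = λ g → subst (X ∋_) (sym (⊞-identityʳ g))
                   , subst (X ∋_) (sym (trans (cong (g ⊞_) ε⁻¹≈ε) (⊞-identityʳ g)))
    ; closed = λ {a} {b} p q g →
        (λ x → subst (X ∋_) (⊞-assoc g a b) (proj₁ (q _) (proj₁ (p g) x)))
      , (λ x → subst (X ∋_) (sym (sub-+ g a b)) (proj₂ (q _) (proj₂ (p g) x)))
    ; has-- = λ {a} p g → proj₂ (p g) , (λ x → subst (X ∋_) (sym (sub-neg g a)) (proj₁ (p g) x)) }

  -- If g ∈ X but g - h ∉ X, then translation by h would map X together with the extra point g - h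
  -- injectively into X, which is finite.
  stab-intro : ∀ X {h} → (∀ {g} → X ∋ g → X ∋ g ⊞ h) → stab X ∋ h
  stab-intro X {h} into g = into , λ p → decidable-stable (mem? X (g - h)) λ ¬p →
    <-irrefl refl (subst (_≤ card X) (+-comm (card X) 1)
      (length-inj₂ {ys = (g - h) ∷ []} (members-unique X) ([] ∷ []) (_⊞ h) (_⊞ h)
        (∈-members X ∘ into ∘ members-∋ X) (λ { (here refl) → ∈-members X (subst (X ∋_) (sym (sub-add g h)) p) })
        (λ _ _ → ∙-cancelʳ h _ _) (λ _ _ → ∙-cancelʳ h _ _)
        (λ { q (here refl) eq → ¬p (subst (X ∋_) (∙-cancelʳ h _ _ eq) (members-∋ X q)) })))

  -- Kneser's inequality with X in place of the sumset and K in place of |B| + |C|. It is obtained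
  -- for pieces of the sumset before it is obtained for the whole.
  Good : ℕ → Subset → Set
  Good K X = K ≤ card X + card (stab X)

  -- Dyson's e-transform (B , C) ↦ (B ∪ (C + e) , C ∩ (B - e)), iterated until C stabilises B.
  e-transform : ∀ n B C → card C ≤ n → C ∋ 0# →
    ∃ λ X → B ⊆ X × X ⊆ B ⊕ C × Good (card B + card C) X
  e-transform zero B C C≤0 0∈C = contradiction (≤-trans (1≤card C 0∈C) C≤0) λ ()
  e-transform (suc n) B C C≤n 0∈C =
    step (any-G? (λ e → mem? B e ×-dec any-G? (λ c → mem? C c ×-dec ¬? (mem? B (c ⊞ e)))))
    where
    step : Dec (∃ λ e → B ∋ e × ∃ λ c → C ∋ c × ¬ B ∋ c ⊞ e) →
      ∃ λ X → B ⊆ X × X ⊆ B ⊕ C × Good (card B + card C) X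
    -- No translate C + e with e ∈ B leaves B, so C lies in the stabiliser of B and B itself serves
    -- as X.
    step (no ¬escape) = B , id
      , (λ {g} p → g , p , subst (C ∋_) (sym (⊞-inverseʳ g)) 0∈C)
      , +-monoʳ-≤ (card B) (card-⊆ C (stab B) λ {c} c∈C → stab-intro B λ {e} e∈B →
          decidable-stable (mem? B (e ⊞ c)) λ ¬p →
            ¬escape (e , e∈B , c , c∈C , subst (λ z → ¬ B ∋ z) (⊞-comm e c) ¬p))
    -- The total size does not drop, C loses c, and 0 remains in C′ because e ∈ B.
    step (yes (e , e∈B , c , c∈C , c+e∉B)) =
      let X , B′⊆X , X⊆ , good = e-transform n B′ C′
            (≤-pred (<-≤-trans (card-⊂ C′ C proj₁ c∈C (c+e∉B ∘ proj₂)) C≤n))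
            (0∈C , subst (B ∋_) (sym (⊞-identityˡ e)) e∈B)
      in X , (λ p → B′⊆X (inj₁ p)) , (λ p → ⊆-sum (X⊆ p)) , ≤-trans total good
      where
      B′ C′ : Subset
      B′ = B ∪ shift (⊟ e) C
      C′ = C ∩ shift e B
      ⊆-sum : B′ ⊕ C′ ⊆ B ⊕ C
      ⊆-sum {g} (x , inj₁ p , q , _) = x , p , q
      ⊆-sum {g} (x , inj₂ p , _ , q) = _ , q , subst (C ∋_) eq p
        where
        eq : x - e ≡ g - ((g - x) ⊞ e)
        eq = trans (sym (cong (_- e) (sub-sub g x))) (sym (sub-+ g (g - x) e))
      moved : card B + card (C ∖ shift e B) ≤ card B′
      moved = card-inj₂ B (C ∖ shift e B) B′ id (_⊞ e) inj₁
        (λ {y} (p , _) → inj₂ (subst (C ∋_) (sym (add-sub y e)) p))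
        (λ _ _ eq → eq) (λ _ _ → ∙-cancelʳ e _ _) (λ { p (_ , q) refl → q p })
      split : ∀ {g} → C ∋ g → C ∖ shift e B ∋ g ⊎ C′ ∋ g
      split {g} p with mem? B (g ⊞ e)
      ... | yes q = inj₂ (p , q)
      ... | no ¬q = inj₁ (p , ¬q)
      total : card B + card C ≤ card B′ + card C′
      total = begin
        card B + card C                               ≤⟨ +-monoʳ-≤ (card B) (card-cover C (C ∖ shift e B) C′ split) ⟩
        card B + (card (C ∖ shift e B) + card C′)   ≡⟨ +-assoc (card B) _ _ ⟨
        card B + card (C ∖ shift e B) + card C′     ≤⟨ +-monoˡ-≤ (card C′) moved ⟩
        card B′ + card C′ ∎
        where open ≤-Reasoning

  -- Opposite translations by u - b keep the sumset and bring u into the first set and 0 into the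
  -- second. The transform only enlarges the first set, so u survives in X.
  good-at : ∀ B C {u} → B ⊕ C ∋ u → ∃ λ X → X ∋ u × X ⊆ B ⊕ C × Good (card B + card C) X
  good-at B C {u} (b , b∈B , c∈C)
    with X , B₁⊆X , X⊆ , good ← e-transform _ (shift (⊟ (u - b)) B) (shift (u - b) C) ≤-refl
           (subst (C ∋_) (sym (⊞-identityˡ _)) c∈C)
    = X , B₁⊆X (subst (B ∋_) (sym eq₁) b∈B) , (λ {g} p → back (X⊆ p))
    , ≤-trans (+-mono-≤ (card-shift _ B) (card-shift _ C)) good
    where
    t = u - b
    eq₁ : u - t ≡ b
    eq₁ = sub-sub u b
    back : ∀ {g} → shift (⊟ t) B ⊕ shift t C ∋ g → B ⊕ C ∋ g
    back {g} (x , p , q) = x - t , p , subst (C ∋_) (sym eq₂) q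
      where
      eq₂ : g - (x - t) ≡ (g - x) ⊞ t
      eq₂ = trans (sub-+ g x (⊟ t)) (sub-neg (g - x) t)

  module _ (H : Subset) (isSubgroup : IsSubgroup H) where
    open IsSubgroup isSubgroup

    private
      first : {P : G → Set} → Decidable P → List G → G
      first P? [] = 0#
      first P? (x ∷ xs) with P? x
      ... | yes _ = x
      ... | no _  = first P? xs

      first-∋ : {P : G → Set} (P? : Decidable P) (xs : List G) {x : G} → x ∈ xs → P x → P (first P? xs)
      first-∋ P? (x ∷ xs) p q with P? x
      first-∋ P? (x ∷ xs) p q | yes r = r
      first-∋ P? (x ∷ xs) (here refl) q | no ¬r = contradiction q ¬r
      first-∋ P? (x ∷ xs) (there p) q | no ¬r = first-∋ P? xs p q

      first-cong : {P Q : G → Set} (P? : Decidable P) (Q? : Decidable Q) →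
        (∀ {x} → P x → Q x) → (∀ {x} → Q x → P x) → (xs : List G) → first P? xs ≡ first Q? xs
      first-cong P? Q? to from [] = refl
      first-cong P? Q? to from (x ∷ xs) with P? x | Q? x
      ... | yes _ | yes _ = refl
      ... | yes p | no ¬q = contradiction (to p) ¬q
      ... | no ¬p | yes q = contradiction (from q) ¬p
      ... | no _  | no _  = first-cong P? Q? to from xs

      -- The element of g + H that comes first in the enumeration, hence the same for all elements
      -- of a coset.
      rep : G → G
      rep g = first (λ y → mem? H (g - y)) elems

      rep-∋ : ∀ g → H ∋ g - rep g
      rep-∋ g = first-∋ (λ y → mem? H (g - y)) elems (complete g) (subst (H ∋_) (sym (⊞-inverseʳ g)) has-0)

      rep-cong : ∀ {g h} → H ∋ g - h → rep g ≡ rep h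
      rep-cong {g} {h} p = first-cong _ _
        (λ {x} q → subst (H ∋_) (telescope h g x) (closed (subst (H ∋_) neg (has-- p)) q))
        (λ {x} q → subst (H ∋_) (telescope g h x) (closed p q)) elems
        where
        neg : ⊟ (g - h) ≡ h - g
        neg = trans (sym (⁻¹-∙-comm g (⊟ h))) (trans (cong ((⊟ g) ⊞_) (⁻¹-involutive h)) (⊞-comm _ _))

    -- The fibres of (r , q) ↦ x ⊞ r ⊞ q on R × Q lie in cosets of H.
    grid : ∀ R Q D x → (∀ {r q r′ q′} → R ∋ r → Q ∋ q → R ∋ r′ → Q ∋ q′ → r ⊞ q ≡ r′ ⊞ q′ → H ∋ r - r′) →
      (∀ {r q} → R ∋ r → Q ∋ q → D ∋ x ⊞ (r ⊞ q)) → card R * card Q ≤ card H * card D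
    grid R Q D x fibre into = length-inj-× (members-unique R) (members-unique Q)
      -- The second coordinate determines r up to H, the first determines r within its coset, and
      -- then q follows.
      (λ (r , q) → (r - rep r) , (x ⊞ (r ⊞ q)))
      (λ {r} {q} p p′ → ∈-members H (rep-∋ r) , ∈-members D (into (members-∋ R p) (members-∋ Q p′)))
      (λ {r} {q} {r′} {q′} p₁ p₂ p₃ p₄ eq → injective (members-∋ R p₁) (members-∋ Q p₂) (members-∋ R p₃) (members-∋ Q p₄)
         (cong proj₁ eq) (∙-cancelˡ x _ _ (cong proj₂ eq)))
      where
      injective : ∀ {r q r′ q′} → R ∋ r → Q ∋ q → R ∋ r′ → Q ∋ q′ →
        r - rep r ≡ r′ - rep r′ → r ⊞ q ≡ r′ ⊞ q′ → (r , q) ≡ (r′ , q′)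
      injective {r} {q} {r′} {q′} p₁ p₂ p₃ p₄ eq₁ eq₂ = cong₂ _,_ r≡r′
        (∙-cancelˡ r q q′ (trans eq₂ (cong (_⊞ q′) (sym r≡r′))))
        where
        r≡r′ : r ≡ r′
        r≡r′ = ∙-cancelʳ (⊟ rep r) r r′ (trans eq₁ (cong (λ z → r′ - z) (sym (rep-cong (fibre p₁ p₂ p₃ p₄ eq₂)))))

  ∩-isSubgroup : ∀ {H K} → IsSubgroup H → IsSubgroup K → IsSubgroup (H ∩ K)
  ∩-isSubgroup h k = record
    { has-0  = has-0 h , has-0 k
    ; closed = λ (p , p′) (q , q′) → closed h p q , closed k p′ q′
    ; has--  = λ (p , p′) → has-- h p , has-- k p′ }
    where open IsSubgroup

  ∩-fibre : ∀ {H K} → IsSubgroup H → IsSubgroup K → ∀ {r q r′ q′} → H ∋ r → K ∋ q → H ∋ r′ → K ∋ q′ →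
    r ⊞ q ≡ r′ ⊞ q′ → H ∩ K ∋ r - r′
  ∩-fibre {H} {K} h k {r} {q} {r′} {q′} p₁ p₂ p₃ p₄ eq =
    closed h p₁ (has-- h p₃) , subst (K ∋_) (sym r-r′) (closed k p₄ (has-- k p₂))
    where
    open IsSubgroup
    r-r′ : r - r′ ≡ q′ - q
    r-r′ = ∙-cancelʳ q _ _ (trans (swapʳ r (⊟ r′) q) (trans (cong (_- r′) eq)
      (trans (add-sub′ r′ q′) (sym (sub-add q′ q)))))

  -- One of two non-nested sets gains at least its defect by passing to their union:
  -- otherwise count X₂ ∖ X₁ and X₁ ∖ X₂ within a coset of H₁ ⊞ H₂.
  private
    module Side (X₁ X₂ : Subset) where
      H₁ H₂ H : Subset
      H₁ = stab X₁
      H₂ = stab X₂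
      H  = H₁ ∩ H₂
      s₁ = stab-isSubgroup X₁
      s₂ = stab-isSubgroup X₂
      open IsSubgroup

      row col row′ col′ : G → Subset
      row  x = record { mem = λ h → H₁ ∋ h × X₂ ∋ x ⊞ h ; mem? = λ h → mem? H₁ h ×-dec mem? X₂ (x ⊞ h) }
      row′ x = record { mem = λ h → H₁ ∋ h × ¬ X₂ ∋ x ⊞ h ; mem? = λ h → mem? H₁ h ×-dec ¬? (mem? X₂ (x ⊞ h)) }
      col  x = record { mem = λ h → H₂ ∋ h × ¬ X₁ ∋ x ⊞ h ; mem? = λ h → mem? H₂ h ×-dec ¬? (mem? X₁ (x ⊞ h)) }
      col′ x = record { mem = λ h → H₂ ∋ h × X₁ ∋ x ⊞ h ; mem? = λ h → mem? H₂ h ×-dec mem? X₁ (x ⊞ h) }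

      -- For r ∈ H₁ and q ∈ H₂, whether x + r + q lies in X₂ depends on r alone, and whether it lies
      -- in X₁ on q alone. So inside the coset x + H₁ + H₂ both differences are rectangles, `row x`
      -- by `col x` and `row′ x` by `col′ x`, with fibres that are cosets of H.
      size-bound : ∀ x → X₂ ∋ x → ¬ X₁ ∋ x →
        suc (card (X₂ ∖ X₁) + card H) ≤ card H₁ → suc (card (X₁ ∖ X₂) + card H) ≤ card H₂ →
        card H₂ < card H₁
      size-bound x x∈ x∉ small₁ small₂ = compare (any-G? (mem? (col′ x)))
        where
        split-row : ∀ {h} → H₁ ∋ h → Dec (X₂ ∋ x ⊞ h) → row x ∋ h ⊎ row′ x ∋ h
        split-row p (yes q) = inj₁ (p , q)
        split-row p (no ¬q) = inj₂ (p , ¬q)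
        split-col : ∀ {h} → H₂ ∋ h → Dec (X₁ ∋ x ⊞ h) → col x ∋ h ⊎ col′ x ∋ h
        split-col p (yes q) = inj₂ (p , q)
        split-col p (no ¬q) = inj₁ (p , ¬q)
        area₁ : card (row x) * card (col x) ≤ card H * card (X₂ ∖ X₁)
        area₁ = grid H (∩-isSubgroup s₁ s₂) (row x) (col x) (X₂ ∖ X₁) x
          (λ p₁ p₂ p₃ p₄ → ∩-fibre s₁ s₂ (proj₁ p₁) (proj₁ p₂) (proj₁ p₃) (proj₁ p₄))
          (λ {r} {q} (r∈ , x+r∈) (q∈ , x+q∉) →
              subst (X₂ ∋_) (⊞-assoc x r q) (proj₁ (q∈ _) x+r∈)
            , λ p → x+q∉ (subst (X₁ ∋_) (trans (cong (_- r) (trans (sym (⊞-assoc x r q)) (swapʳ x r q))) (add-sub _ r))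
                (proj₂ (r∈ _) p)))
        area₂ : card (col′ x) * card (row′ x) ≤ card H * card (X₁ ∖ X₂)
        area₂ = grid H (∩-isSubgroup s₁ s₂) (col′ x) (row′ x) (X₁ ∖ X₂) x
          (λ p₁ p₂ p₃ p₄ eq → let a , b = ∩-fibre s₂ s₁ (proj₁ p₁) (proj₁ p₂) (proj₁ p₃) (proj₁ p₄) eq in b , a)
          (λ {r} {q} (r∈ , x+r∈) (q∈ , x+q∉) →
              subst (X₁ ∋_) (⊞-assoc x r q) (proj₁ (q∈ _) x+r∈)
            , λ p → x+q∉ (subst (X₂ ∋_) (trans (cong (_- r) (trans (sym (⊞-assoc x r q)) (swapʳ x r q))) (add-sub _ r))
                (proj₂ (r∈ _) p)))
        H≤row : card H ≤ card (row x)
        H≤row = card-⊆ H (row x) λ (p , q) → p , proj₁ (q x) x∈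
        H≤col : card H ≤ card (col x)
        H≤col = card-⊆ H (col x) λ {h} (p , q) → q , λ r → x∉ (subst (X₁ ∋_) (add-sub x h) (proj₂ (p _) r))
        1≤H : 1 ≤ card H
        1≤H = 1≤card H (has-0 (∩-isSubgroup s₁ s₂))
        compare : Dec (∃ λ h → col′ x ∋ h) → card H₂ < card H₁
        compare (yes (s , s∈H₂ , x+s∈X₁)) = ⊥-elim (grid-arith
          (card (row x)) (card (row′ x)) (card (col x)) (card (col′ x)) (card H) (card (X₂ ∖ X₁)) (card (X₁ ∖ X₂))
          area₁ area₂
          (≤-trans small₁ (card-cover H₁ (row x) (row′ x) λ {h} p → split-row p (mem? X₂ (x ⊞ h))))
          (≤-trans small₂ (card-cover H₂ (col x) (col′ x) λ {h} p → split-col p (mem? X₁ (x ⊞ h))))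
          H≤row H≤col
          (card-inj H (col′ x) (s ⊞_)
             (λ {h} (p , q) → closed s₂ s∈H₂ q , subst (X₁ ∋_) (⊞-assoc x s h) (proj₁ (p _) x+s∈X₁))
             (λ _ _ → ∙-cancelˡ s _ _))
          1≤H)
        -- X₁ misses x + H₂, so every element of H₂ is in `col x`, and the rectangle alone yields
        -- |H₂| points of X₂ outside X₁.
        compare (no empty) = ≤-<-trans
          (*-cancelˡ-≤ (card H) ⦃ ℕ.>-nonZero 1≤H ⦄ (≤-trans (*-mono-≤ H≤row H₂≤col) area₁))
          (≤-<-trans (m≤m+n _ (card H)) small₁)
          where
          H₂≤col : card H₂ ≤ card (col x)
          H₂≤col = card-⊆ H₂ (col x) λ {h} p → p , λ q → empty (h , p , q)

  union-good : ∀ {K} X₁ X₂ {x₁ x₂} → Good K X₁ → Good K X₂ →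
    X₁ ∋ x₁ → ¬ X₂ ∋ x₁ → X₂ ∋ x₂ → ¬ X₁ ∋ x₂ → Good K (X₁ ∪ X₂)
  union-good {K} X₁ X₂ {x₁} {x₂} good₁ good₂ p₁ ¬p₁ p₂ ¬p₂ = decide (_ ≤? _) (_ ≤? _)
    where
    open ≤-Reasoning
    H = stab X₁ ∩ stab X₂
    H⊆ : H ⊆ stab (X₁ ∪ X₂)
    H⊆ (q₁ , q₂) g = (λ { (inj₁ p) → inj₁ (proj₁ (q₁ g) p) ; (inj₂ p) → inj₂ (proj₁ (q₂ g) p) })
                   , (λ { (inj₁ p) → inj₁ (proj₂ (q₁ g) p) ; (inj₂ p) → inj₂ (proj₂ (q₂ g) p) })
    enlarge : ∀ X Y → card (Y ∖ X) + card X ≤ card (X₁ ∪ X₂) →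
      Good K X → card (stab X) ≤ card (Y ∖ X) + card H → Good K (X₁ ∪ X₂)
    enlarge X Y sum≤ good defect = begin
      K                                                 ≤⟨ good ⟩
      card X + card (stab X)                          ≤⟨ +-monoʳ-≤ (card X) defect ⟩
      card X + (card (Y ∖ X) + card H)              ≡⟨ +-assoc (card X) _ _ ⟨
      card X + card (Y ∖ X) + card H                ≡⟨ cong (_+ card H) (+-comm (card X) _) ⟩
      card (Y ∖ X) + card X + card H                ≤⟨ +-mono-≤ sum≤ (card-⊆ H (stab (X₁ ∪ X₂)) H⊆) ⟩
      card (X₁ ∪ X₂) + card (stab (X₁ ∪ X₂))          ∎
    decide : Dec (card (stab X₁) ≤ card (X₂ ∖ X₁) + card H) → Dec (card (stab X₂) ≤ card (X₁ ∖ X₂) + card H) →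
      Good K (X₁ ∪ X₂)
    decide (yes d) _ = enlarge X₁ X₂ (card-disjoint (X₂ ∖ X₁) X₁ (X₁ ∪ X₂) (inj₂ ∘ proj₁) inj₁ proj₂) good₁ d
    decide (no _) (yes d) = enlarge X₂ X₁ (card-disjoint (X₁ ∖ X₂) X₂ (X₁ ∪ X₂) (inj₁ ∘ proj₁) inj₂ proj₂) good₂ d
    -- The rectangles at x₂ give |stab X₂| < |stab X₁|, those at x₁ the reverse.
    decide (no ¬d₁) (no ¬d₂) = contradiction
      (Side.size-bound X₂ X₁ x₁ p₁ ¬p₁ (swap (≰⇒> ¬d₂)) (swap (≰⇒> ¬d₁)))
      (<-asym (Side.size-bound X₁ X₂ x₂ p₂ ¬p₂ (≰⇒> ¬d₁) (≰⇒> ¬d₂)))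
      where
      swap : ∀ {a b} → suc (a + card H) ≤ b → suc (a + card (stab X₂ ∩ stab X₁)) ≤ b
      swap {a} = ≤-trans (s≤s (+-monoʳ-≤ a (card-⊆ (stab X₂ ∩ stab X₁) H λ (p , q) → q , p)))

  -- Every element of the sumset lies in a good piece, and pieces are merged until they exhaust it.
  -- In `grow` the number n bounds how many elements are still uncovered.
  kneser : ∀ B C {u} → B ⊕ C ∋ u → Good (card B + card C) (B ⊕ C)
  kneser B C {u} u∈ =
    let X , u∈X , X⊆U , good = good-at B C u∈ in grow (card U) X u∈X X⊆U good (m≤n+m _ (card X))
    where
    U = B ⊕ C
    K = card B + card C
    grow : ∀ n X → X ∋ u → X ⊆ U → Good K X → card U ≤ card X + n → Good K U
    finish : ∀ X → X ⊆ U → U ⊆ X → Good K X → Good K U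
    finish X X⊆U U⊆X good = ≤-trans good (+-mono-≤ (card-⊆ X U X⊆U)
      (card-⊆ (stab X) (stab U) λ p g → (λ q → X⊆U (proj₁ (p g) (U⊆X q))) , λ q → X⊆U (proj₂ (p g) (U⊆X q))))
    grow n X u∈X X⊆U good bound with any-G? (λ v → mem? U v ×-dec ¬? (mem? X v))
    ... | no ¬more = finish X X⊆U (λ {g} p → decidable-stable (mem? X g) λ ¬q → ¬more (g , p , ¬q)) good
    grow zero X u∈X X⊆U good bound | yes (v , v∈U , v∉X) = contradiction
      (≤-trans bound (≤-reflexive (+-identityʳ _))) (<⇒≱ (card-⊂ X U X⊆U v∈U v∉X))
    grow (suc n) X u∈X X⊆U good bound | yes (v , v∈U , v∉X)
      with Y , v∈Y , Y⊆U , goodY ← good-at B C v∈U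
      with any-G? (λ z → mem? X z ×-dec ¬? (mem? Y z))
    ... | yes (z , z∈X , z∉Y) = grow n (X ∪ Y) (inj₁ u∈X) (λ { (inj₁ p) → X⊆U p ; (inj₂ p) → Y⊆U p })
          (union-good X Y good goodY z∈X z∉Y v∈Y v∉X)
          (≤-trans bound (≤-trans (≤-reflexive (+-suc (card X) n))
            (+-monoˡ-≤ n (card-⊂ X (X ∪ Y) inj₁ (inj₂ v∈Y) v∉X))))
    -- `union-good` asks for sets that are not nested. Here X ⊆ Y, and Y, which contains v as well,
    -- takes over.
    ... | no ¬z = grow n Y (X⊆Y u∈X) Y⊆U goodY
          (≤-trans bound (≤-trans (≤-reflexive (+-suc (card X) n))
            (+-monoˡ-≤ n (card-⊂ X Y X⊆Y v∈Y v∉X))))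
      where
      X⊆Y : X ⊆ Y
      X⊆Y {g} p = decidable-stable (mem? Y g) λ ¬q → ¬z (g , p , ¬q)

  -- |B + C| ≥ |B + H| + |C + H| - |H| for H = stab (B + C), by applying kneser to B and C + H;
  -- the coset c + H of H in C + H contains at most |H| - |C ∩ (c + H)| elements outside C.
  kneser-coset : ∀ B C {u c} → B ⊕ C ∋ u → C ∋ c → let H = stab (B ⊕ C) in
    card B + card C ≤ card (B ⊕ C) + card (C ∩ shift (⊟ c) H)
  kneser-coset B C {u} {c} u∈ c∈C = +-cancelʳ-≤ (card H) _ _ (begin
    card B + card C + card H                          ≤⟨ +-monoʳ-≤ (card B + card C) H-split ⟩
    card B + card C + (card D + card (shift (⊟ c) H ∖ C))  ≡⟨ rearrange (card B) (card C) (card D) _ ⟩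
    card B + (card C + card (shift (⊟ c) H ∖ C)) + card D  ≤⟨ +-monoˡ-≤ (card D) (+-monoʳ-≤ (card B) C-split) ⟩
    card B + card C⁺ + card D                         ≤⟨ +-monoˡ-≤ (card D) (kneser B C⁺ {u} (U⊆ u∈)) ⟩
    card (B ⊕ C⁺) + card (stab (B ⊕ C⁺)) + card D     ≤⟨ +-monoˡ-≤ (card D) (+-mono-≤ (card-⊆ (B ⊕ C⁺) U ⊆U)
        (card-⊆ (stab (B ⊕ C⁺)) H λ p g → (λ q → ⊆U (proj₁ (p g) (U⊆ q))) , λ q → ⊆U (proj₂ (p g) (U⊆ q)))) ⟩
    card U + card H + card D                          ≡⟨ trans (+-assoc (card U) _ _) (trans (cong (card U +_) (+-comm (card H) _)) (sym (+-assoc (card U) _ _))) ⟩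
    card U + card D + card H ∎)
    where
    open ≤-Reasoning
    U H C⁺ D : Subset
    U = B ⊕ C
    H = stab U
    D = C ∩ shift (⊟ c) H
    C⁺ = C ⊕ H
    open IsSubgroup (stab-isSubgroup U)
    rearrange : ∀ b c d e → b + c + (d + e) ≡ b + (c + e) + d
    rearrange = solve-∀
    U⊆ : U ⊆ B ⊕ C⁺
    U⊆ {g} (b , p , q) = b , p , g - b , q , subst (H ∋_) (sym (⊞-inverseʳ (g - b))) has-0
    ⊆U : B ⊕ C⁺ ⊆ U
    ⊆U {g} (b , p , c′ , q , h∈) = subst (U ∋_) eq (proj₁ (h∈ (b ⊞ c′)) (⊕-intro B C p q))
      where
      eq : (b ⊞ c′) ⊞ ((g - b) - c′) ≡ g
      eq = trans (cong ((b ⊞ c′) ⊞_) (sym (sub-+ g b c′))) (trans (⊞-comm _ _) (sub-add g (b ⊞ c′)))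
    H-split : card H ≤ card D + card (shift (⊟ c) H ∖ C)
    H-split = ≤-trans (card-shift (⊟ c) H) (card-cover (shift (⊟ c) H) D (shift (⊟ c) H ∖ C) λ {g} p → split p (mem? C g))
      where
      split : ∀ {g} → H ∋ g - c → Dec (C ∋ g) → D ∋ g ⊎ shift (⊟ c) H ∖ C ∋ g
      split p (yes q) = inj₁ (q , p)
      split p (no ¬q) = inj₂ (p , ¬q)
    C-split : card C + card (shift (⊟ c) H ∖ C) ≤ card C⁺
    C-split = card-disjoint C (shift (⊟ c) H ∖ C) C⁺
      (λ {g} p → g , p , subst (H ∋_) (sym (⊞-inverseʳ g)) has-0) (λ (p , _) → c , c∈C , p) (λ p (_ , q) → q p)

-- Residues modulo l

module Residues (l : ℕ) .⦃ _ : NonZero l ⦄ where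

  infixl 6 _⊞_

  abstract
    cls : ℕ → Fin l
    cls z = z mod l

    toℕ-cls : ∀ z → toℕ (cls z) ≡ z % l
    toℕ-cls z = toℕ-fromℕ< (m%n<n z l)

    cls-cong : ∀ {x y} → x % l ≡ y % l → cls x ≡ cls y
    cls-cong {x} {y} eq = toℕ-injective (trans (toℕ-cls x) (trans eq (sym (toℕ-cls y))))

    cls-cancel : ∀ {x y} → cls x ≡ cls y → x % l ≡ y % l
    cls-cancel {x} {y} eq = trans (sym (toℕ-cls x)) (trans (cong toℕ eq) (toℕ-cls y))

    cls-toℕ : ∀ g → cls (toℕ g) ≡ g
    cls-toℕ g = toℕ-injective (trans (toℕ-cls (toℕ g)) (m<n⇒m%n≡m (toℕ<n g)))

    _⊞_ : Fin l → Fin l → Fin l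
    g ⊞ h = cls (toℕ g + toℕ h)

    ⊟_ : Fin l → Fin l
    ⊟ g = cls (l ∸ toℕ g)

    cls-+ : ∀ x y → cls (x + y) ≡ cls x ⊞ cls y
    cls-+ x y = cls-cong (begin
      (x + y) % l                        ≡⟨ %-distribˡ-+ x y l ⟩
      (x % l + y % l) % l                ≡⟨ cong₂ (λ a b → (a + b) % l) (sym (toℕ-cls x)) (sym (toℕ-cls y)) ⟩
      (toℕ (cls x) + toℕ (cls y)) % l    ∎)
      where open ≡-Reasoning

    cls-l : cls l ≡ cls 0
    cls-l = cls-cong ([m+n]%n≡m%n 0 l)

    cls-+k*l : ∀ x k → cls (x + k * l) ≡ cls x
    cls-+k*l x k = cls-cong ([m+kn]%n≡m%n x k l)

    cls-+l : ∀ x → cls (x + l) ≡ cls x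
    cls-+l x = cls-cong ([m+n]%n≡m%n x l)

    -- The group laws hold in ℕ and pass to the quotient along cls.
    private
      ⊞-comm : ∀ g h → g ⊞ h ≡ h ⊞ g
      ⊞-comm g h = cong cls (+-comm (toℕ g) (toℕ h))
      ⊞-identityʳ : ∀ g → g ⊞ cls 0 ≡ g
      ⊞-identityʳ g = trans (cong (_⊞ cls 0) (sym (cls-toℕ g)))
        (trans (sym (cls-+ (toℕ g) 0)) (trans (cong cls (+-identityʳ (toℕ g))) (cls-toℕ g)))
      ⊞-assoc : ∀ g h k → (g ⊞ h) ⊞ k ≡ g ⊞ (h ⊞ k)
      ⊞-assoc g h k = begin
        (g ⊞ h) ⊞ k                             ≡⟨ cong ((g ⊞ h) ⊞_) (cls-toℕ k) ⟨
        cls (toℕ g + toℕ h) ⊞ cls (toℕ k)       ≡⟨ cls-+ (toℕ g + toℕ h) (toℕ k) ⟨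
        cls (toℕ g + toℕ h + toℕ k)             ≡⟨ cong cls (+-assoc (toℕ g) (toℕ h) (toℕ k)) ⟩
        cls (toℕ g + (toℕ h + toℕ k))           ≡⟨ cls-+ (toℕ g) (toℕ h + toℕ k) ⟩
        cls (toℕ g) ⊞ (h ⊞ k)                   ≡⟨ cong (_⊞ (h ⊞ k)) (cls-toℕ g) ⟩
        g ⊞ (h ⊞ k)                             ∎
        where open ≡-Reasoning
      ⊞-inverseʳ : ∀ g → g ⊞ (⊟ g) ≡ cls 0
      ⊞-inverseʳ g = begin
        g ⊞ (⊟ g)                           ≡⟨ cong (_⊞ (⊟ g)) (cls-toℕ g) ⟨
        cls (toℕ g) ⊞ cls (l ∸ toℕ g)       ≡⟨ cls-+ (toℕ g) (l ∸ toℕ g) ⟨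
        cls (toℕ g + (l ∸ toℕ g))           ≡⟨ cong cls (m+[n∸m]≡n (<⇒≤ (toℕ<n g))) ⟩
        cls l                               ≡⟨ cls-l ⟩
        cls 0                               ∎
        where open ≡-Reasoning

    isAbelianGroup : IsAbelianGroup _≡_ _⊞_ (cls 0) ⊟_
    isAbelianGroup = record
      { isGroup = record
        { isMonoid = record
          { isSemigroup = record
            { isMagma = record { isEquivalence = isEquivalence ; ∙-cong = cong₂ _⊞_ }
            ; assoc = ⊞-assoc }
          ; identity = (λ g → trans (⊞-comm (cls 0) g) (⊞-identityʳ g)) , ⊞-identityʳ }
        ; inverse = (λ g → trans (⊞-comm (⊟ g) g) (⊞-inverseʳ g)) , ⊞-inverseʳ
        ; ⁻¹-cong = cong ⊟_ }
      ; comm = ⊞-comm }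

    %-≡-<⇒+l≤ : ∀ {x y} → x % l ≡ y % l → x < y → x + l ≤ y
    %-≡-<⇒+l≤ {x} {y} eq x<y = begin
      x + l                            ≡⟨ cong (_+ l) (m≡m%n+[m/n]*n x l) ⟩
      x % l + x / l * l + l            ≡⟨ +-assoc (x % l) _ l ⟩
      x % l + (x / l * l + l)          ≡⟨ cong (x % l +_) (+-comm _ l) ⟩
      x % l + suc (x / l) * l          ≤⟨ +-monoʳ-≤ (x % l) (*-monoˡ-≤ l quotients) ⟩
      x % l + y / l * l                ≡⟨ cong (_+ y / l * l) eq ⟩
      y % l + y / l * l                ≡⟨ m≡m%n+[m/n]*n y l ⟨
      y ∎
      where
      open ≤-Reasoning
      quotients : x / l < y / l
      quotients = *-cancelʳ-< l (x / l) (y / l) (+-cancelˡ-< (x % l) _ _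
        (subst₂ _<_ (m≡m%n+[m/n]*n x l) (trans (m≡m%n+[m/n]*n y l) (cong (_+ y / l * l) (sym eq))) x<y))

    %-≡-≤⇒+k*l : ∀ {x y} → x % l ≡ y % l → x ≤ y → ∃ λ k → x + k * l ≡ y
    %-≡-≤⇒+k*l {x} {y} eq x≤y = y / l ∸ x / l , (begin
      x + (y / l ∸ x / l) * l                      ≡⟨ cong (_+ (y / l ∸ x / l) * l) (m≡m%n+[m/n]*n x l) ⟩
      x % l + x / l * l + (y / l ∸ x / l) * l      ≡⟨ +-assoc (x % l) _ _ ⟩
      x % l + (x / l * l + (y / l ∸ x / l) * l)    ≡⟨ cong (x % l +_) (*-distribʳ-+ l (x / l) _) ⟨
      x % l + (x / l + (y / l ∸ x / l)) * l        ≡⟨ cong₂ (λ a b → a + b * l) eq (m+[n∸m]≡n (/-mono x≤y)) ⟩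
      y % l + y / l * l                            ≡⟨ m≡m%n+[m/n]*n y l ⟨
      y ∎)
      where
      open ≡-Reasoning
      /-mono : x ≤ y → x / l ≤ y / l
      /-mono = /-monoˡ-≤ l

  ⊞-abelianGroup : AbelianGroup _ _
  ⊞-abelianGroup = record { isAbelianGroup = isAbelianGroup }

-- The conductors of ⟨A⟩ and ⟨l - A⟩

module Apéry (l : ℕ) .⦃ _ : NonZero l ⦄ (A : List ℕ) (A-unique : Unique A) (0∈A : 0 ∈ A) (l∈A : l ∈ A)
  (A≤l : ∀ {a} → a ∈ A → a ≤ l) where

  open Residues l public
  open FiniteGroup isAbelianGroup (allFin l) ∈-allFin (allFin⁺ l) public
  open Subset
  open IsAbelianGroup isAbelianGroup using (assoc; comm; inverseʳ)
  open import Algebra.Properties.AbelianGroup ⊞-abelianGroup using (⁻¹-∙-comm; ε⁻¹≈ε; ∙-cancelˡ)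

  -- Meant are the Apéry functions of ⟨A⟩ and ⟨l - A⟩, which send a class to its least element in
  -- the semigroup. `generates` expresses that the residues of A generate the group.
  module Bounds (ap ap′ : Fin l → ℕ)
    (cls-ap : ∀ g → cls (ap g) ≡ g) (ap-⊞ : ∀ g h → ap (g ⊞ h) ≤ ap g + ap h)
    (ap′-⊞ : ∀ g h → ap′ (g ⊞ h) ≤ ap′ g + ap′ h)
    (ap-A : ∀ {a} → a ∈ A → ap (cls a) ≤ a) (ap′-A : ∀ {a} → a ∈ A → ap′ (⊟ cls a) ≤ l ∸ a)
    (generates : ∀ U → U ∋ cls 0 → (∀ {g a} → a ∈ A → U ∋ g → U ∋ g ⊞ cls a) → ∀ g → U ∋ g) where

    Ā : Subset
    Ā = record { mem = λ g → ∃ λ a → a ∈ A × g ≡ cls a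
               ; mem? = λ g → map′ find (λ (a , a∈ , eq) → lose a∈ eq) (any? (λ a → g Fin.≟ cls a) A) }

    -- The level set {t ≤ h}; comparing with h l avoids a division.
    S : ℕ → Subset
    S h = record { mem = λ g → ap g + ap′ (⊟ g) ≤ h * l ; mem? = λ g → _ ℕ.≤? _ }

    N : ℕ → ℕ
    N h = card (S h)

    -- Only 0 and l share a residue.
    length-A≤ : length A ≤ suc (card Ā)
    length-A≤ = ≤-trans (length-remove l A-unique)
      (s≤s (length-inj (filter⁺ _ A-unique) cls
        (λ {a} p → ∈-members Ā (a , proj₁ (∈-filter⁻ (λ a → ¬? (a ℕ.≟ l)) p) , refl))
        (λ p q eq → trans (sym (small p)) (trans (cls-cancel eq) (small q)))))
      where
      small : ∀ {a} → a ∈ filter (λ a → ¬? (a ℕ.≟ l)) A → a % l ≡ a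
      small p = let a∈ , a≢l = ∈-filter⁻ (λ a → ¬? (a ℕ.≟ l)) p in m<n⇒m%n≡m (≤∧≢⇒< (A≤l a∈) a≢l)

    ⊟-⊞ : ∀ g h → ⊟ (g ⊞ h) ≡ (⊟ g) ⊞ (⊟ h)
    ⊟-⊞ g h = sym (⁻¹-∙-comm g h)

    cls-0 : S 0 ∋ cls 0
    cls-0 = +-mono-≤ (ap-A 0∈A) (subst (λ g → ap′ g ≤ 0) ⊟cls-l (≤-trans (ap′-A l∈A) (≤-reflexive (n∸n≡0 l))))
      where
      ⊟cls-l : ⊟ cls l ≡ ⊟ cls 0
      ⊟cls-l = cong ⊟_ cls-l

    -- A generator a costs at most a on the side of A and l - a on the side of l - A, together one
    -- level.
    S-step : ∀ h {g a} → S h ∋ g → a ∈ A → S (suc h) ∋ g ⊞ cls a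
    S-step h {g} {a} p a∈A = begin
      ap (g ⊞ cls a) + ap′ (⊟ (g ⊞ cls a))                ≡⟨ cong (λ z → ap (g ⊞ cls a) + ap′ z) (⊟-⊞ g (cls a)) ⟩
      ap (g ⊞ cls a) + ap′ ((⊟ g) ⊞ (⊟ cls a))            ≤⟨ +-mono-≤ (ap-⊞ _ _) (ap′-⊞ _ _) ⟩
      (ap g + ap (cls a)) + (ap′ (⊟ g) + ap′ (⊟ cls a))   ≤⟨ +-mono-≤ (+-monoʳ-≤ (ap g) (ap-A a∈A)) (+-monoʳ-≤ _ (ap′-A a∈A)) ⟩
      (ap g + a) + (ap′ (⊟ g) + (l ∸ a))                  ≡⟨ rearrange (ap g) a (ap′ (⊟ g)) (l ∸ a) ⟩
      (a + (l ∸ a)) + (ap g + ap′ (⊟ g))                  ≡⟨ cong (_+ (ap g + ap′ (⊟ g))) (m+[n∸m]≡n (A≤l a∈A)) ⟩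
      l + (ap g + ap′ (⊟ g))                              ≤⟨ +-monoʳ-≤ l p ⟩
      l + h * l ∎
      where
      open ≤-Reasoning
      rearrange : ∀ x a y b → (x + a) + (y + b) ≡ (a + b) + (x + y)
      rearrange = solve-∀

    -- Let x be the largest Apéry element over a coset u ⊞ H ⊆ S (suc h), y₁ the least element of A in
    -- c ⊞ H, and y > y₁ another one. The class of x + y also contains an element of the semigroup below
    -- x + y, through y₁; so x + y ∸ l lies in the semigroup, which saves one level.
    exit : ∀ h H → IsSubgroup H → ∀ u {c} → c ∈ A → (∀ {g} → H ∋ g - u → S h ∋ g) →
      ∃ λ g₀ → H ∋ g₀ - u × ∃ λ g₁ → ∀ {g} → Ā ∋ g → H ∋ g - cls c → g ≢ g₁ → S h ∋ g₀ ⊞ g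
    exit h H isSub u {c} c∈A coset⊆S = g₀ , g₀∈ , cls y₁ , step
      where
      open IsSubgroup isSub
      coset : List (Fin l)
      coset = filter (λ g → mem? H (g - u)) (allFin l)
      g₀ : Fin l
      g₀ = Extrema.argmax ap u coset
      g₀∈ : H ∋ g₀ - u
      g₀∈ = Extrema.argmax-all ap {P = λ g → H ∋ g - u} (subst (H ∋_) (sym (inverseʳ u)) has-0)
        (All.tabulate λ p → proj₂ (∈-filter⁻ (λ g → mem? H (g - u)) {xs = allFin l} p))
      ap≤ : ∀ {g} → H ∋ g - u → ap g ≤ ap g₀
      ap≤ {g} p = All.lookup (Extrema.f[xs]≤f[argmax] {f = ap} u coset) (∈-filter⁺ (λ g → mem? H (g - u)) (∈-allFin g) p)
      ys : List ℕ
      ys = filter (λ y → mem? H (cls y - cls c)) A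
      y₁ : ℕ
      y₁ = Extrema.argmin id c ys
      y₁∈ : y₁ ∈ A × H ∋ cls y₁ - cls c
      y₁∈ = Extrema.argmin-all id {P = λ y → y ∈ A × H ∋ cls y - cls c} (c∈A , subst (H ∋_) (sym (inverseʳ (cls c))) has-0)
        (All.tabulate (∈-filter⁻ (λ y → mem? H (cls y - cls c))))
      step : ∀ {g} → Ā ∋ g → H ∋ g - cls c → g ≢ cls y₁ → S h ∋ g₀ ⊞ g
      step {g} (y , y∈A , refl) g∈ g≢ = +-cancelʳ-≤ l _ _ (begin
        ap ρ + ap′ (⊟ ρ) + l                                 ≡⟨ swap₂ (ap ρ) (ap′ (⊟ ρ)) l ⟩
        ap ρ + l + ap′ (⊟ ρ)                                 ≤⟨ +-mono-≤ above below ⟩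
        (ap g₀ + y) + (ap′ (⊟ g₀) + (l ∸ y))                 ≡⟨ rearrange (ap g₀) y (ap′ (⊟ g₀)) (l ∸ y) ⟩
        ap g₀ + ap′ (⊟ g₀) + (y + (l ∸ y))                   ≡⟨ cong (ap g₀ + ap′ (⊟ g₀) +_) (m+[n∸m]≡n (A≤l y∈A)) ⟩
        ap g₀ + ap′ (⊟ g₀) + l                               ≤⟨ +-monoˡ-≤ l (coset⊆S g₀∈) ⟩
        h * l + l ∎)
        where
        open ≤-Reasoning
        swap₂ : ∀ a b c → a + b + c ≡ a + c + b
        swap₂ = solve-∀
        rearrange : ∀ x a y b → (x + a) + (y + b) ≡ (x + y) + (a + b)
        rearrange = solve-∀
        ρ w : Fin l
        ρ = g₀ ⊞ cls y
        w = ρ - cls y₁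
        w∈ : H ∋ w - u
        w∈ = subst (H ∋_) (sym (trans (cong (_- u) (assoc g₀ (cls y) (⊟ cls y₁))) (swapʳ g₀ (cls y - cls y₁) (⊟ u))))
          (closed g₀∈ (subst (H ∋_) (trans (cong (_- (cls y₁ - cls c)) (sym (telescope (cls y) (cls y₁) (cls c)))) (add-sub _ _))
            (closed g∈ (has-- (proj₂ y₁∈)))))
        y₁<y : y₁ < y
        y₁<y = ≤∧≢⇒< (All.lookup (Extrema.f[argmin]≤f[xs] {f = id} c ys) (∈-filter⁺ (λ y → mem? H (cls y - cls c)) y∈A g∈))
          λ eq → g≢ (cong cls (sym eq))
        -- As w lies in u + H, maximality of g₀ gives `ap ρ` ≤ `ap g₀` + y₁ < `ap g₀` + y. The two
        -- ends are congruent, hence at least l apart.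
        above : ap ρ + l ≤ ap g₀ + y
        above = %-≡-<⇒+l≤ (cls-cancel (trans (cls-ap ρ) (sym (trans (cls-+ (ap g₀) y) (cong (_⊞ cls y) (cls-ap g₀)))))) (begin-strict
          ap ρ                   ≡⟨ cong ap (sub-add ρ (cls y₁)) ⟨
          ap (w ⊞ cls y₁)        ≤⟨ ap-⊞ w (cls y₁) ⟩
          ap w + ap (cls y₁)     ≤⟨ +-mono-≤ (ap≤ w∈) (ap-A (proj₁ y₁∈)) ⟩
          ap g₀ + y₁             <⟨ +-monoʳ-< (ap g₀) y₁<y ⟩
          ap g₀ + y ∎)
        below : ap′ (⊟ ρ) ≤ ap′ (⊟ g₀) + (l ∸ y)
        below = begin
          ap′ (⊟ ρ)                         ≡⟨ cong ap′ (⊟-⊞ g₀ (cls y)) ⟩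
          ap′ ((⊟ g₀) ⊞ (⊟ cls y))          ≤⟨ ap′-⊞ _ _ ⟩
          ap′ (⊟ g₀) + ap′ (⊟ cls y)        ≤⟨ +-monoʳ-≤ _ (ap′-A y∈A) ⟩
          ap′ (⊟ g₀) + (l ∸ y) ∎

    Full : ℕ → Set
    Full h = ∀ g → S h ∋ g

    Full-suc : ∀ h → Full h → Full (suc h)
    Full-suc h full g = ≤-trans (full g) (m≤n+m (h * l) l)

    -- By `kneser-coset` the shortfall of U is at most |D|, where D is the part of Ā in the coset of
    -- c. Of this, `exit` makes up |D| - 1 in the coset of u + c, which misses U. For trivial H the
    -- set D is a single element and nothing has to be made up.
    growth : ∀ h → N h + card Ā ≤ suc (N (suc h)) ⊎ Full (suc h)
    growth h = decide (any-G? λ g → mem? U g ×-dec any? (λ a → ¬? (mem? U (g ⊞ cls a))) A)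
      where
      U : Subset
      U = S h ⊕ Ā
      H : Subset
      H = stab U
      open IsSubgroup (stab-isSubgroup U)
      U⊆S : U ⊆ S (suc h)
      U⊆S {g} (x , x∈ , a , a∈A , eq) = subst (S (suc h) ∋_) (trans (cong (x ⊞_) (sym eq)) (trans (comm x (g - x)) (sub-add g x)))
        (S-step h x∈ a∈A)
      S0⊆ : ∀ h → S h ∋ cls 0
      S0⊆ h = ≤-trans cls-0 z≤n
      0∈U : U ∋ cls 0
      0∈U = cls 0 , S0⊆ h , 0 , 0∈A , inverseʳ (cls 0)
      decide : Dec (∃ λ g → U ∋ g × _) → _
      decide (no stuck) = inj₂ λ g → U⊆S (generates U 0∈U
        (λ {g} {a} a∈A p → decidable-stable (mem? U (g ⊞ cls a)) λ ¬q → stuck (g , p , lose a∈A ¬q)) g)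
      decide (yes (u , u∈U , esc))
        with c , c∈A , u+c∉U ← find esc
        -- The coset of u lies in U and so already in level h + 1; hence `exit` delivers elements of
        -- level h + 1, not h + 2.
        with g₀ , g₀∈ , g₁ , new ← exit (suc h) H (stab-isSubgroup U) u c∈A
               (λ {g} p → U⊆S (subst (U ∋_) (trans (comm u (g - u)) (sub-add g u)) (proj₁ (p u) u∈U)))
        = inj₁ (begin
        N h + card Ā               ≤⟨ kneser-coset (S h) Ā u∈U (c , c∈A , refl) ⟩
        card U + card D            ≤⟨ +-monoʳ-≤ (card U) D≤ ⟩
        card U + suc (card D⁻)     ≡⟨ +-suc (card U) (card D⁻) ⟩
        suc (card U + card D⁻)     ≤⟨ s≤s (card-inj₂ U D⁻ (S (suc h)) id (g₀ ⊞_) U⊆S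
                                        (λ ((p , q) , r) → new p q r) (λ _ _ eq → eq) (λ _ _ → ∙-cancelˡ g₀ _ _)
                                        λ { {y = g} p (((_ , q) , _)) refl → u+c∉U (outside p q) }) ⟩
        suc (N (suc h)) ∎)
        where
        open ≤-Reasoning
        D D⁻ : Subset
        D  = Ā ∩ shift (⊟ cls c) H
        D⁻ = record { mem = λ g → D ∋ g × g ≢ g₁ ; mem? = λ g → mem? D g ×-dec ¬? (g Fin.≟ g₁) }
        D≤ : card D ≤ suc (card D⁻)
        D≤ = length-inj {ys = g₁ ∷ members D⁻} (members-unique D) id
          (λ {g} p → into (members-∋ D p) (g Fin.≟ g₁)) (λ _ _ eq → eq)
          where
          into : ∀ {g} → D ∋ g → Dec (g ≡ g₁) → g ∈ g₁ ∷ members D⁻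
          into p (yes eq) = here eq
          into p (no ne)  = there (∈-members D⁻ (p , ne))
        outside : ∀ {g} → U ∋ g₀ ⊞ g → H ∋ g - cls c → U ∋ u ⊞ cls c
        outside {g} p q = subst (U ∋_) eq (proj₂ (closed g₀∈ q _) p)
          where
          eq : (g₀ ⊞ g) - ((g₀ - u) ⊞ (g - cls c)) ≡ u ⊞ cls c
          eq = trans (sub-+ (g₀ ⊞ g) (g₀ - u) (g - cls c)) (trans (cong (_- (g - cls c))
                 (trans (swapʳ g₀ g (⊟ (g₀ - u))) (cong (_⊞ g) (sub-sub g₀ u))))
                 (trans (assoc u g _) (cong (u ⊞_) (sub-sub g (cls c)))))

    N≤l : ∀ h → N h ≤ l
    N≤l h = subst (N h ≤_) (length-tabulate {n = l} id) (length-inj (members-unique (S h)) id (λ {g} _ → ∈-allFin g) (λ _ _ eq → eq))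

    Full⇒l≤N : ∀ h → Full h → l ≤ N h
    Full⇒l≤N h full = subst (_≤ N h) (length-tabulate {n = l} id)
      (length-inj (allFin⁺ l) id (λ {g} _ → ∈-members (S h) (full g)) (λ _ _ eq → eq))

    N-lower : ∀ ν → suc ν ≤ card Ā → ∀ h → suc (h * ν) ≤ N h ⊎ Full h
    N-lower ν ν<Ā zero = inj₁ (1≤card (S 0) cls-0)
    N-lower ν ν<Ā (suc h) with N-lower ν ν<Ā h
    ... | inj₂ full = inj₂ (Full-suc h full)
    ... | inj₁ ih with growth h
    ...   | inj₂ full = inj₂ full
    ...   | inj₁ step = inj₁ (≤-pred (begin
      suc (suc (ν + h * ν))       ≡⟨ e ν (h * ν) ⟩
      suc (h * ν) + suc ν         ≤⟨ +-mono-≤ ih ν<Ā ⟩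
      N h + card Ā                ≤⟨ step ⟩
      suc (N (suc h)) ∎))
      where
      open ≤-Reasoning
      e : ∀ a b → suc (suc (a + b)) ≡ suc b + suc a
      e = solve-∀

    -- For the Apéry functions and x ≤ m l this says that x ∈ ⟨A⟩ and m l - x ∈ ⟨l - A⟩. Thus `W m`
    -- is [0, m l] without E and m l - E′, and `W̅ m` collects the removed points.
    InW : ℕ → ℕ → Set
    InW m x = ap (cls x) ≤ x × ap′ (⊟ cls x) ≤ m * l ∸ x

    InW? : ∀ m x → Dec (InW m x)
    InW? m x = (_ ℕ.≤? _) ×-dec (_ ℕ.≤? _)

    W W̅ : ℕ → List ℕ
    W m = filter (InW? m) (upTo (suc (m * l)))
    W̅ m = filter (¬? ∘ InW? m) (upTo (suc (m * l)))

    W-unique : ∀ m → Unique (W m)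
    W-unique m = filter⁺ (InW? m) (upTo⁺ _)

    ∈-W : ∀ m {x} → x ≤ m * l → InW m x → x ∈ W m
    ∈-W m x≤ = ∈-filter⁺ (InW? m) (∈-upTo⁺ (s≤s x≤))

    W-∋ : ∀ m {x} → x ∈ W m → x ≤ m * l × InW m x
    W-∋ m p = let q , w = ∈-filter⁻ (InW? m) {xs = upTo (suc (m * l))} p in ≤-pred (∈-upTo⁻ q) , w

    -- In the class g, raising `W m` by l gives elements above `ap g`, and `ap g` itself joins them
    -- once t(g) ≤ m + 1. Iteration produces the sum of the N(h).
    W-step : ∀ m → length (W m) + N (suc m) ≤ length (W (suc m))
    W-step m = length-inj₂ (W-unique m) (members-unique (S (suc m))) (_+ l) ap
      (λ {x} p → let x≤ , p₁ , p₂ = W-∋ m p in ∈-W (suc m)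
         (≤-trans (+-monoˡ-≤ l x≤) (≤-reflexive (+-comm (m * l) l)))
         ( subst (λ g → ap g ≤ x + l) (sym (cls-+l x)) (≤-trans p₁ (m≤m+n x l))
         , subst₂ (λ g d → ap′ (⊟ g) ≤ d) (sym (cls-+l x))
             (sym (trans (cong (_∸ (x + l)) (+-comm l (m * l))) ([m+n]∸[o+n] (m * l) x))) p₂))
      (λ {g} p → let p′ = members-∋ (S (suc m)) p in ∈-W (suc m) (m+n≤o⇒m≤o (ap g) p′)
         ( ≤-reflexive (cong ap (cls-ap g))
         , subst (λ z → ap′ (⊟ z) ≤ suc m * l ∸ ap g) (sym (cls-ap g)) (m+n≤o⇒n≤o∸m p′)))
      (λ _ _ → +-cancelʳ-≡ l _ _)
      (λ {g} {h} _ _ eq → trans (sym (cls-ap g)) (trans (cong cls eq) (cls-ap h)))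
      (λ {x} {g} p _ eq → <-irrefl refl (<-≤-trans (x<ap eq) (proj₁ (proj₂ (W-∋ m p)))))
      where
      [m+n]∸[o+n] : ∀ a b → (a + l) ∸ (b + l) ≡ a ∸ b
      [m+n]∸[o+n] a b = trans (cong₂ _∸_ (+-comm a l) (+-comm b l)) ([m+n]∸[m+o]≡n∸o l a b)
      m+n≤o⇒n≤o∸m : ∀ {a b c} → a + b ≤ c → b ≤ c ∸ a
      m+n≤o⇒n≤o∸m {a} {b} {c} p = subst (_≤ c ∸ a) (m+n∸m≡n a b) (∸-monoˡ-≤ a p)
      x<ap : ∀ {x g} → x + l ≡ ap g → x < ap (cls x)
      x<ap {x} {g} eq = begin-strict
        x                  <⟨ m<m+n x (ℕ.>-nonZero⁻¹ l) ⟩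
        x + l              ≡⟨ eq ⟩
        ap g               ≡⟨ cong ap (trans (sym (cls-ap g)) (trans (cong cls (sym eq)) (cls-+l x))) ⟩
        ap (cls x) ∎
        where open ≤-Reasoning

    -- φ and φ′ are the conductors. If e = φ ∸ 1 is a gap then x and e ∸ x are not both in the semigroup.
    W-upper : ∀ m φ φ′ → (∀ {e} → φ ≡ suc e → e < ap (cls e)) → (∀ {e} → φ′ ≡ suc e → e < ap′ (cls e)) →
      φ + φ′ ≤ suc (m * l) → length (W m) + length (W m) + (φ + φ′) ≤ suc (m * l) + suc (m * l)
    W-upper m φ φ′ gap gap′ disjoint = begin
      length (W m) + length (W m) + (φ + φ′)                           ≤⟨ +-monoʳ-≤ (length (W m) + length (W m)) gaps ⟩
      length (W m) + length (W m) + (length (W̅ m) + length (W̅ m))     ≡⟨ e (length (W m)) (length (W̅ m)) ⟩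
      (length (W m) + length (W̅ m)) + (length (W m) + length (W̅ m))   ≤⟨ +-mono-≤ whole whole ⟩
      suc (m * l) + suc (m * l) ∎
      where
      open ≤-Reasoning
      e : ∀ a b → a + a + (b + b) ≡ (a + b) + (a + b)
      e = solve-∀
      whole : length (W m) + length (W̅ m) ≤ suc (m * l)
      whole = subst (length (W m) + length (W̅ m) ≤_) (length-upTo (suc (m * l)))
        (length-inj₂ (W-unique m) (filter⁺ (¬? ∘ InW? m) (upTo⁺ (suc (m * l)))) id id
          (proj₁ ∘ ∈-filter⁻ (InW? m)) (proj₁ ∘ ∈-filter⁻ (¬? ∘ InW? m)) (λ _ _ eq → eq) (λ _ _ eq → eq)
          (λ { p q refl → proj₂ (∈-filter⁻ (¬? ∘ InW? m) {xs = upTo (suc (m * l))} q) (proj₂ (W-∋ m p)) }))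
      -- Two copies of the complement. An x < φ goes to itself in the first copy if it is a gap, and
      -- otherwise to the gap φ - 1 - x in the second; `high` does the same for φ′, counted down
      -- from m l. The bound on φ + φ′ keeps the two ends apart.
      twice : List (ℕ ⊎ ℕ)
      twice = map inj₁ (W̅ m) ++ map inj₂ (W̅ m)
      low : ℕ → ℕ ⊎ ℕ
      low x with ap (cls x) ℕ.≤? x
      ... | yes _ = inj₂ (φ ∸ 1 ∸ x)
      ... | no _  = inj₁ x
      high : ℕ → ℕ ⊎ ℕ
      high y with ap′ (cls y) ℕ.≤? y
      ... | yes _ = inj₂ (m * l ∸ (φ′ ∸ 1 ∸ y))
      ... | no _  = inj₁ (m * l ∸ y)
      in-W̅₁ : ∀ {x} → x ≤ m * l → ¬ InW m x → inj₁ x ∈ twice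
      in-W̅₁ x≤ ¬w = ∈-++⁺ˡ (∈-map⁺ inj₁ (∈-filter⁺ (¬? ∘ InW? m) (∈-upTo⁺ (s≤s x≤)) ¬w))
      in-W̅₂ : ∀ {x} → x ≤ m * l → ¬ InW m x → inj₂ x ∈ twice
      in-W̅₂ x≤ ¬w = ∈-++⁺ʳ (map inj₁ (W̅ m)) (∈-map⁺ inj₂ (∈-filter⁺ (¬? ∘ InW? m) (∈-upTo⁺ (s≤s x≤)) ¬w))
      φ≤ : φ ≤ suc (m * l)
      φ≤ = m+n≤o⇒m≤o φ disjoint
      φ′≤ : φ′ ≤ suc (m * l)
      φ′≤ = m+n≤o⇒n≤o φ disjoint
      mirror : ∀ {p : Fin l → ℕ} → (∀ g h → p (g ⊞ h) ≤ p g + p h) → ∀ {φ x} → (∀ {e} → φ ≡ suc e → e < p (cls e)) →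
        x < φ → p (cls x) ≤ x → ¬ p (cls (φ ∸ 1 ∸ x)) ≤ φ ∸ 1 ∸ x
      mirror {p} p-⊞ {suc e} {x} gap (s≤s x≤e) px q = <-irrefl refl (begin-strict
        e                                       <⟨ gap refl ⟩
        p (cls e)                               ≡⟨ cong (p ∘ cls) (sym (m+[n∸m]≡n x≤e)) ⟩
        p (cls (x + (e ∸ x)))                   ≡⟨ cong p (cls-+ x (e ∸ x)) ⟩
        p (cls x ⊞ cls (e ∸ x))                 ≤⟨ p-⊞ _ _ ⟩
        p (cls x) + p (cls (e ∸ x))             ≤⟨ +-mono-≤ px q ⟩
        x + (e ∸ x)                             ≡⟨ m+[n∸m]≡n x≤e ⟩
        e ∎)
      low∈ : ∀ {x} → x < φ → low x ∈ twice
      low∈ {x} x<φ with ap (cls x) ℕ.≤? x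
      ... | yes p = in-W̅₂ (≤-trans (m∸n≤m (φ ∸ 1) x) (∸-monoˡ-≤ 1 φ≤)) (λ (q , _) → mirror {ap} ap-⊞ gap x<φ p q)
      ... | no ¬p = in-W̅₁ (≤-pred (<-≤-trans x<φ φ≤)) (¬p ∘ proj₁)
      ⊟-top : ∀ {y} → y ≤ m * l → ⊟ cls (m * l ∸ y) ≡ cls y
      ⊟-top {y} y≤ = ∙-cancelˡ (cls (m * l ∸ y)) _ _ (trans (inverseʳ _)
        (trans (sym (trans (cong cls (m∸n+n≡m y≤)) (cls-+k*l 0 m))) (cls-+ (m * l ∸ y) y)))
      top : ∀ {y} → y ≤ m * l → ¬ ap′ (cls y) ≤ y → ¬ InW m (m * l ∸ y)
      top {y} y≤ ¬p (_ , q) = ¬p (subst₂ (λ g d → ap′ g ≤ d) (⊟-top y≤) (m∸[m∸n]≡n y≤) q)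
      high∈ : ∀ {y} → y < φ′ → high y ∈ twice
      high∈ {y} y<φ′ with ap′ (cls y) ℕ.≤? y
      ... | yes p = in-W̅₂ (m∸n≤m (m * l) (φ′ ∸ 1 ∸ y)) (top {φ′ ∸ 1 ∸ y} (≤-trans (m∸n≤m (φ′ ∸ 1) y) (∸-monoˡ-≤ 1 φ′≤)) (mirror {ap′} ap′-⊞ gap′ y<φ′ p))
      ... | no ¬p = in-W̅₁ (m∸n≤m (m * l) y) (top (≤-pred (<-≤-trans y<φ′ φ′≤)) ¬p)
      pred≤ : ∀ {φ x} → x < φ → x ≤ φ ∸ 1
      pred≤ (s≤s p) = p
      low-inj : ∀ {x x′} → x < φ → x′ < φ → low x ≡ low x′ → x ≡ x′
      low-inj {x} {x′} p q eq with ap (cls x) ℕ.≤? x | ap (cls x′) ℕ.≤? x′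
      ... | yes _ | yes _ = ∸-cancelˡ-≡ (pred≤ p) (pred≤ q) (inj₂-injective eq)
      ... | no _  | no _  = inj₁-injective eq
      high-inj : ∀ {y y′} → y < φ′ → y′ < φ′ → high y ≡ high y′ → y ≡ y′
      high-inj {y} {y′} p q eq with ap′ (cls y) ℕ.≤? y | ap′ (cls y′) ℕ.≤? y′
      ... | yes _ | yes _ = ∸-cancelˡ-≡ (pred≤ p) (pred≤ q)
            (∸-cancelˡ-≡ (≤-trans (m∸n≤m (φ′ ∸ 1) y) (∸-monoˡ-≤ 1 φ′≤)) (≤-trans (m∸n≤m (φ′ ∸ 1) y′) (∸-monoˡ-≤ 1 φ′≤))
              (inj₂-injective eq))
      ... | no _  | no _  = ∸-cancelˡ-≡ (≤-pred (<-≤-trans p φ′≤)) (≤-pred (<-≤-trans q φ′≤)) (inj₁-injective eq)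
      separated : ∀ {x y} → x < φ → y < φ′ → ¬ x ≡ m * l ∸ y
      separated {x} {y} p q refl = <-irrefl refl (begin-strict
        m * l               ≡⟨ m∸n+n≡m (≤-pred (<-≤-trans q φ′≤)) ⟨
        m * l ∸ y + y       <⟨ ≤-pred (≤-trans (subst (_≤ φ + φ′) (cong suc (+-suc _ y)) (+-mono-≤ p q)) disjoint) ⟩
        m * l ∎)
      low≢high : ∀ {x y} → x < φ → y < φ′ → ¬ low x ≡ high y
      low≢high {x} {y} p q eq with ap (cls x) ℕ.≤? x | ap′ (cls y) ℕ.≤? y
      ... | yes _ | yes _ = separated (≤-<-trans (m∸n≤m (φ ∸ 1) x) (pred< p)) (≤-<-trans (m∸n≤m (φ′ ∸ 1) y) (pred< q))
              (inj₂-injective eq)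
        where
        pred< : ∀ {φ x} → x < φ → φ ∸ 1 < φ
        pred< (s≤s p) = ≤-refl
      ... | no _  | no _  = separated p q (inj₁-injective eq)
      gaps : φ + φ′ ≤ length (W̅ m) + length (W̅ m)
      gaps = subst₂ _≤_ (cong₂ _+_ (length-upTo φ) (length-upTo φ′))
        (trans (length-++ (map inj₁ (W̅ m))) (cong₂ _+_ (length-map inj₁ (W̅ m)) (length-map inj₂ (W̅ m))))
        (length-inj₂ (upTo⁺ φ) (upTo⁺ φ′) low high
          (λ p → low∈ (∈-upTo⁻ p)) (λ p → high∈ (∈-upTo⁻ p))
          (λ p q → low-inj (∈-upTo⁻ p) (∈-upTo⁻ q)) (λ p q → high-inj (∈-upTo⁻ p) (∈-upTo⁻ q))
          (λ p q → low≢high (∈-upTo⁻ p) (∈-upTo⁻ q)))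

    -- The left side is twice the sum of 1 + i ν over i ≤ h, doubled to avoid halves. The limit h ≤
    -- k keeps i ν below l, so a full level also satisfies the bound on N.
    W-lower : ∀ ν k → suc ν ≤ card Ā → suc (k * ν) ≤ l → ∀ h → h ≤ k →
      2 + (h * suc h * ν + 2 * h) ≤ length (W h) + length (W h)
    W-lower ν k ν<Ā kν<l zero h≤k = +-mono-≤ 1≤W 1≤W
      where
      1≤W : 1 ≤ length (W 0)
      1≤W = length-inj {xs = 0 ∷ []} ([] ∷ []) id
        (λ { (here refl) → ∈-W 0 z≤n (m+n≤o⇒m≤o _ cls-0 , m+n≤o⇒n≤o (ap (cls 0)) cls-0) }) (λ _ _ eq → eq)
    W-lower ν k ν<Ā kν<l (suc h) h<k = begin
      2 + (suc h * suc (suc h) * ν + 2 * suc h)                            ≡⟨ e h ν ⟩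
      2 + (h * suc h * ν + 2 * h) + (suc (suc h * ν) + suc (suc h * ν))    ≤⟨ +-mono-≤ (W-lower ν k ν<Ā kν<l h (<⇒≤ h<k)) (+-mono-≤ N≥ N≥) ⟩
      length (W h) + length (W h) + (N (suc h) + N (suc h))                ≡⟨ e′ (length (W h)) (N (suc h)) ⟩
      (length (W h) + N (suc h)) + (length (W h) + N (suc h))              ≤⟨ +-mono-≤ (W-step h) (W-step h) ⟩
      length (W (suc h)) + length (W (suc h)) ∎
      where
      open ≤-Reasoning
      e : ∀ h ν → 2 + (suc h * suc (suc h) * ν + 2 * suc h) ≡ 2 + (h * suc h * ν + 2 * h) + (suc (suc h * ν) + suc (suc h * ν))
      e = solve-∀
      e′ : ∀ a b → a + a + (b + b) ≡ (a + b) + (a + b)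
      e′ = solve-∀
      N≥ : suc (suc h * ν) ≤ N (suc h)
      N≥ with N-lower ν ν<Ā (suc h)
      ... | inj₁ p = p
      ... | inj₂ full = ≤-trans (s≤s (*-monoˡ-≤ ν h<k)) (≤-trans kν<l (Full⇒l≤N (suc h) full))

    W-lower-full : ∀ k → (∀ j → Full (suc (k + j))) → ∀ j → length (W k) + j * l ≤ length (W (k + j))
    W-lower-full k full zero = ≤-reflexive (trans (+-identityʳ _) (cong (length ∘ W) (sym (+-identityʳ k))))
    W-lower-full k full (suc j) = begin
      length (W k) + (l + j * l)                 ≡⟨ e (length (W k)) l (j * l) ⟩
      length (W k) + j * l + l                   ≤⟨ +-mono-≤ (W-lower-full k full j) (Full⇒l≤N (suc (k + j)) (full j)) ⟩
      length (W (k + j)) + N (suc (k + j))       ≤⟨ W-step (k + j) ⟩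
      length (W (suc (k + j)))                   ≡⟨ cong (length ∘ W) (+-suc k j) ⟨
      length (W (k + suc j)) ∎
      where
      open ≤-Reasoning
      e : ∀ a b c → a + (b + c) ≡ a + c + b
      e = solve-∀

    -- That is, φ + φ′ is at most twice Castelnuovo's bound for the genus of a curve of degree l in P^(ν + 1).
    conductors : ∀ ν k φ φ′ → suc ν ≤ card Ā → suc (k * ν) ≤ l → l ≤ suc k * ν →
      (∀ {e} → φ ≡ suc e → e < ap (cls e)) → (∀ {e} → φ′ ≡ suc e → e < ap′ (cls e)) →
      φ + φ′ + (k * suc k * ν + 2 * k) ≤ 2 * (k * l)
    conductors ν k φ φ′ ν<Ā kν<l l≤ gap gap′ = +-cancelʳ-≤ (2 + (j * l + j * l)) _ _ (begin
      φ + φ′ + q + (2 + (j * l + j * l))                          ≡⟨ e₁ (φ + φ′) q (j * l) ⟩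
      (2 + q) + (j * l + j * l) + (φ + φ′)                        ≤⟨ +-monoˡ-≤ (φ + φ′) (+-monoˡ-≤ (j * l + j * l) (W-lower ν k ν<Ā kν<l k ≤-refl)) ⟩
      length (W k) + length (W k) + (j * l + j * l) + (φ + φ′)    ≡⟨ cong (_+ (φ + φ′)) (e₂ (length (W k)) (j * l)) ⟩
      (length (W k) + j * l) + (length (W k) + j * l) + (φ + φ′)  ≤⟨ +-monoˡ-≤ (φ + φ′) (+-mono-≤ (W-lower-full k full j) (W-lower-full k full j)) ⟩
      length (W (k + j)) + length (W (k + j)) + (φ + φ′)          ≤⟨ W-upper (k + j) φ φ′ gap gap′ big ⟩
      suc ((k + j) * l) + suc ((k + j) * l)                       ≡⟨ e₃ k j l ⟩
      2 * (k * l) + (2 + (j * l + j * l)) ∎)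
      where
      open ≤-Reasoning
      j q : ℕ
      -- Any j will do for which the two ends fit disjointly into [0, (k + j) l], because the terms
      -- j l cancel.
      j = φ + φ′
      q = k * suc k * ν + 2 * k
      e₁ : ∀ a b c → a + b + (2 + (c + c)) ≡ (2 + b) + (c + c) + a
      e₁ = solve-∀
      e₂ : ∀ a b → a + a + (b + b) ≡ (a + b) + (a + b)
      e₂ = solve-∀
      e₃ : ∀ k j l → suc ((k + j) * l) + suc ((k + j) * l) ≡ 2 * (k * l) + (2 + (j * l + j * l))
      e₃ = solve-∀
      big : φ + φ′ ≤ suc ((k + j) * l)
      big = begin
        j                    ≤⟨ m≤m*n j l ⟩
        j * l                ≤⟨ *-monoˡ-≤ l (m≤n+m j k) ⟩
        (k + j) * l          ≤⟨ n≤1+n _ ⟩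
        suc ((k + j) * l) ∎
      -- Past level k the linear lower bound on N would exceed l, as l ≤ (k + 1) ν.
      full : ∀ i → Full (suc (k + i))
      full i with N-lower ν ν<Ā (suc (k + i))
      ... | inj₂ f = f
      ... | inj₁ p = contradiction (begin-strict
        suc k * ν            ≤⟨ *-monoˡ-≤ ν (s≤s (m≤m+n k i)) ⟩
        suc (k + i) * ν      <⟨ p ⟩
        N (suc (k + i))      ≤⟨ N≤l (suc (k + i)) ⟩
        l                    ≤⟨ l≤ ⟩
        suc k * ν ∎) (<-irrefl refl)

-- The structure theorem

-- The scan stops at the first `Hi` index from 1 on and remembers the last `Lo` index before it. It
-- serves to find a stretch of partial sums that match none of the other representation.
low-high : {Lo Hi : ℕ → Set} → Decidable Lo → Decidable Hi → ∀ n → Lo 0 → ¬ Hi 0 → Hi n →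
  ∃₂ λ i j → i < j × j ≤ n × Lo i × Hi j × (∀ {k} → i < k → k < j → ¬ Lo k × ¬ Hi k)
low-high Lo? Hi? zero lo ¬hi hi = contradiction hi ¬hi
low-high {Lo} {Hi} Lo? Hi? (suc n) lo ¬hi hi = scan n 0 1 refl lo (s≤s z≤n) λ { (s≤s z≤n) (s≤s ()) }
  where
  scan : ∀ d i j → j + d ≡ suc n → Lo i → i < j → (∀ {k} → i < k → k < j → ¬ Lo k × ¬ Hi k) →
    ∃₂ λ i j → i < j × j ≤ suc n × Lo i × Hi j × (∀ {k} → i < k → k < j → ¬ Lo k × ¬ Hi k)
  scan d i j eq lo i<j un with Hi? j
  ... | yes hj = i , j , i<j , subst (j ≤_) eq (m≤m+n j d) , lo , hj , un
  scan zero i j eq lo i<j un | no ¬hj = contradiction (subst Hi (trans (sym eq) (+-identityʳ j)) hi) ¬hj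
  scan (suc d) i j eq lo i<j un | no ¬hj with Lo? j
  ... | yes lj = scan d j (suc j) (trans (sym (+-suc j d)) eq) lj ≤-refl λ p q → contradiction (≤-pred q) (<⇒≱ p)
  ... | no ¬lj = scan d i (suc j) (trans (sym (+-suc j d)) eq) lo (m≤n⇒m≤1+n i<j) λ p q → extend p (m≤n⇒m<n∨m≡n (≤-pred q))
    where
    extend : ∀ {k} → i < k → k < j ⊎ k ≡ j → ¬ Lo k × ¬ Hi k
    extend p (inj₁ q) = un p q
    extend p (inj₂ refl) = ¬lj , ¬hj

InSumset-suc : ∀ {A k x a} → a ∈ A → InSumset k A x → InSumset (suc k) A (a + x)
InSumset-suc a∈A (xs , len , xs⊆A , s) = _ ∷ xs , cong suc len , a∈A ∷ xs⊆A , cong (_ +_) s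

InSumset-+ : ∀ {A k k′ x x′} → InSumset k A x → InSumset k′ A x′ → InSumset (k + k′) A (x + x′)
InSumset-+ (xs , len , xs⊆A , s) (ys , len′ , ys⊆A , s′) =
  xs ++ ys , trans (length-++ xs) (cong₂ _+_ len len′) , All.++⁺ xs⊆A ys⊆A , trans (sum-++ xs ys) (cong₂ _+_ s s′)

InSumset-* : ∀ {A a} → a ∈ A → ∀ k → InSumset k A (k * a)
InSumset-* a∈A zero = [] , refl , [] , refl
InSumset-* a∈A (suc k) = InSumset-suc a∈A (InSumset-* a∈A k)

InSumset? : ∀ k A x → Dec (InSumset k A x)
InSumset? zero A zero = yes ([] , refl , [] , refl)
InSumset? zero A (suc x) = no λ { ([] , _ , _ , ()) }
InSumset? (suc k) A x = map′ to from (any? (λ a → (a ℕ.≤? x) ×-dec InSumset? k A (x ∸ a)) A)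
  where
  Removable : ℕ → Set
  Removable a = a ≤ x × InSumset k A (x ∸ a)
  to : Any Removable A → InSumset (suc k) A x
  to p = let a , a∈A , a≤x , r = find p in subst (InSumset (suc k) A) (m+[n∸m]≡n a≤x) (InSumset-suc a∈A r)
  from : InSumset (suc k) A x → Any Removable A
  from (a ∷ xs , len , a∈A ∷ xs⊆A , refl) = lose a∈A
    (m≤m+n a (sum xs) , xs , suc-injective len , xs⊆A , sym (m+n∸m≡n a (sum xs)))

module Sumset (A : List ℕ) (A-unique : Unique A) (0∈A : 0 ∈ A) (l : ℕ) .⦃ l≢0 : NonZero l ⦄ (l∈A : l ∈ A)
  (A≤l : ∀ {a} → a ∈ A → a ≤ l) where

  open Residues l

  private
    _∈[_]A : ℕ → ℕ → Set
    x ∈[ k ]A = InSumset k A x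

  -- Padding by e copies of l and by zeros; each exchange below that contradicts x ∉ m A ends here.
  reach : ∀ {k m x y} e → y ∈[ k ]A → k + e ≤ m → y + e * l ≡ x → x ∈[ m ]A
  reach {k} {m} {x} {y} e p k+e≤m eq = subst₂ (λ k x → x ∈[ k ]A)
    (m+[n∸m]≡n k+e≤m) (trans (cong₂ _+_ eq (*-zeroʳ (m ∸ (k + e)))) (+-identityʳ x))
    (InSumset-+ (InSumset-+ p (InSumset-* l∈A e)) (InSumset-* 0∈A (m ∸ (k + e))))

  Inner : ℕ → Set
  Inner a = a ∈ A × 0 < a × a < l

  strip : ∀ xs → All (_∈ A) xs → ∃ λ zs → ∃₂ λ u w →
    All Inner zs × length zs + u + w ≡ length xs × sum zs + u * l ≡ sum xs
  strip [] [] = [] , 0 , 0 , [] , refl , refl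
  strip (x ∷ xs) (x∈ ∷ xs⊆) with strip xs xs⊆ | x ℕ.≟ 0 | x ℕ.≟ l
  ... | zs , u , w , zs° , len , s | yes refl | _ = zs , u , suc w , zs° , trans (+-suc _ w) (cong suc len) , s
  ... | zs , u , w , zs° , len , s | no _ | yes refl =
        zs , suc u , w , zs° , trans (cong (_+ w) (+-suc (length zs) u)) (cong suc len)
      , trans (e (sum zs) l (u * l)) (cong (l +_) s)
    where
    e : ∀ a b c → a + (b + c) ≡ b + (a + c)
    e = solve-∀
  ... | zs , u , w , zs° , len , s | no x≢0 | no x≢l =
        x ∷ zs , u , w , (x∈ , n≢0⇒n>0 x≢0 , ≤∧≢⇒< (A≤l x∈) x≢l) ∷ zs° , cong suc len
      , trans (+-assoc x (sum zs) (u * l)) (cong (x +_) s)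

  partial : List ℕ → ℕ → ℕ
  partial xs i = sum (take i xs)

  partial-suc : ∀ {xs} → All Inner xs → ∀ {i} → i < length xs → ∃ λ a → Inner a × partial xs (suc i) ≡ partial xs i + a
  partial-suc (p ∷ ps) {zero} i< = _ , p , +-identityʳ _
  partial-suc {x ∷ xs} (p ∷ ps) {suc i} (s≤s i<) = let a , q , eq = partial-suc ps i< in
    a , q , trans (cong (x +_) eq) (sym (+-assoc x _ a))

  block : ∀ {xs} → All Inner xs → ∀ {i j} → i < j → j ≤ length xs →
    partial xs i < partial xs j × partial xs j + i * l < partial xs i + j * l
  block {xs} ps {i} {suc j} i<j j≤ with partial-suc ps {j} j≤ | m≤n⇒m<n∨m≡n (≤-pred i<j)
  ... | a , (_ , 0<a , a<l) , eq | inj₂ refl rewrite eq =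
        m<m+n _ 0<a , slack-≤ 0 a<l (e (partial xs i) a (i * l) l)
    where
    e : ∀ p a k l → suc (p + a + k) + l + 0 ≡ p + (l + k) + suc a
    e = solve-∀
  ... | a , (_ , 0<a , a<l) , eq | inj₁ i<j′ rewrite eq = let q , r = block ps i<j′ (<⇒≤ j≤) in
        <-≤-trans q (m≤m+n _ a) , slack-≤ 1 (+-mono-≤ r a<l) (e (partial xs i) (partial xs j) a (i * l) (j * l) l)
    where
    e : ∀ p q a k k′ l → suc (q + a + k) + (p + k′ + l) + 1 ≡ p + (l + k′) + (suc (q + k) + suc a)
    e = solve-∀

  block-≤ : ∀ {xs} → All Inner xs → ∀ {i j} → i ≤ j → j ≤ length xs →
    partial xs i ≤ partial xs j × partial xs j + i * l ≤ partial xs i + j * l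
  block-≤ ps i≤j j≤ with m≤n⇒m<n∨m≡n i≤j
  ... | inj₁ i<j = let p , q = block ps i<j j≤ in <⇒≤ p , <⇒≤ q
  ... | inj₂ refl = ≤-refl , ≤-refl

  prefix : ∀ {xs} → All Inner xs → ∀ {i} → i ≤ length xs → partial xs i ∈[ i ]A
  prefix {xs} ps {i} i≤ = take i xs , trans (length-take i xs) (m≤n⇒m⊓n≡m i≤) , All.take⁺ i (All.map proj₁ ps) , refl

  suffix : ∀ {xs} → All Inner xs → ∀ {i} → i ≤ length xs → ∃₂ λ r t → t ∈[ r ]A ×
    i + r ≡ length xs × partial xs i + t ≡ sum xs × length (drop i xs) ≡ r × sum (drop i xs) ≡ t
  suffix {xs} ps {i} i≤ = length (drop i xs) , sum (drop i xs)
    , (drop i xs , refl , All.drop⁺ i (All.map proj₁ ps) , refl)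
    , trans (cong (i +_) (length-drop i xs)) (m+[n∸m]≡n i≤)
    , trans (sym (sum-++ (take i xs) (drop i xs))) (cong sum (take++drop≡id i xs)) , refl , refl

  cancel-*l-< : ∀ {a b} → a * l < b * l → a < b
  cancel-*l-< {a} {b} = *-cancelʳ-< l a b

  quotient-< : ∀ {xs} → All Inner xs → ∀ {i a e} → 0 < i → i ≤ length xs → a + e * l ≡ partial xs i → e < i
  quotient-< {xs} ps {i} {a} {e} 0<i i≤ eq = cancel-*l-< (begin-strict
    e * l               ≤⟨ m≤n+m (e * l) a ⟩
    a + e * l           ≡⟨ eq ⟩
    partial xs i        ≡⟨ +-identityʳ _ ⟨
    partial xs i + 0    <⟨ proj₂ (block ps 0<i i≤) ⟩
    i * l ∎)
    where open ≤-Reasoning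

  -- as and bs are the inner terms of representations of x and of x + l by m + 1 elements each, completed
  -- by u copies of l and by v copies of 0 respectively.
  module Representations {m x : ℕ} (x∉ : ¬ x ∈[ m ]A) (m≥ : l + 2 ∸ length A ≤ m) where

    -- Induction on the number of inner terms, bounded by n: an exchange that keeps the length but
    -- trades at least two inner terms for one is answered by the induction hypothesis.
    impossible : ∀ n as bs u v → All Inner as → All Inner bs →
      length as + u ≡ suc m → sum as + u * l ≡ x → length bs + v ≡ suc m → sum bs ≡ x + l →
      length as + length bs < n → ⊥
    impossible (suc n) as bs u v as° bs° L+u S+ul L′+v B≡ fuel = <-irrefl refl too-many
      where
      s b : ℕ → ℕ
      s = partial as
      b = partial bs
      L L′ : ℕ
      L = length as
      L′ = length bs

      -- A block of inner terms with sum g l has more than g terms, so g copies of l replace it and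
      -- save a term.
      s-distinct : ∀ {i j} → i < j → j ≤ L → s i % l ≢ s j % l
      s-distinct {i} {j} i<j j≤L eq
        with si<sj , below ← block as° i<j j≤L
        with g , si+gl ← %-≡-≤⇒+k*l eq (<⇒≤ si<sj)
        with r , t , t∈ , j+r , sj+t , _ ← suffix as° j≤L
        = x∉ (reach (g + u) (InSumset-+ (prefix as° (≤-trans (<⇒≤ i<j) j≤L)) t∈)
            (slack-≤ 0 (+-mono-≤ i+g<j (≤-reflexive j+r+u)) (e₂ i r g u j m))
            (trans (e₁ (s i) t g u l) (trans (cong (λ z → z + t + u * l) si+gl) (trans (cong (_+ u * l) sj+t) S+ul))))
        where
        j+r+u : j + r + u ≡ suc m
        j+r+u = trans (cong (_+ u) j+r) L+u
        i+g<j : i + g < j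
        i+g<j = cancel-*l-< {i + g} (+-cancelˡ-< (s i) _ _ (subst (_< s i + j * l) (trans (cong (_+ i * l) (sym si+gl)) (e₀ (s i) g i l)) below))
          where
          e₀ : ∀ p g i l → p + g * l + i * l ≡ p + (i + g) * l
          e₀ = solve-∀
        e₁ : ∀ p t g u l → p + t + (g + u) * l ≡ p + g * l + t + u * l
        e₁ = solve-∀
        e₂ : ∀ i r g u j m → i + r + (g + u) + (j + suc m) + 0 ≡ m + (suc (i + g) + (j + r + u))
        e₂ = solve-∀

      -- Here one of the g copies of l is given up to pass from x + l to x; g is positive because
      -- the block sum is.
      b-distinct : ∀ {i j} → i < j → j ≤ L′ → b i % l ≢ b j % l
      b-distinct {i} {j} i<j j≤L′ eq
        with bi<bj , below ← block bs° i<j j≤L′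
        with %-≡-≤⇒+k*l eq (<⇒≤ bi<bj) | suffix bs° j≤L′
      ... | zero , bi+gl | _ = <-irrefl (trans (sym (+-identityʳ _)) bi+gl) bi<bj
      ... | suc g , bi+gl | r , t , t∈ , j+r , bj+t , _
        = x∉ (reach g (InSumset-+ (prefix bs° (≤-trans (<⇒≤ i<j) j≤L′)) t∈)
            (slack-≤ (suc v) (+-mono-≤ i+g<j (≤-reflexive (trans (cong (_+ v) j+r) L′+v))) (e₂ i r g v j m))
            (+-cancelʳ-≡ l _ _ (trans (e₁ (b i) t g l) (trans (cong (_+ t) bi+gl) (trans bj+t B≡)))))
        where
        i+g<j : i + suc g < j
        i+g<j = cancel-*l-< {i + suc g} (+-cancelˡ-< (b i) _ _ (subst (_< b i + j * l) (trans (cong (_+ i * l) (sym bi+gl)) (e₀ (b i) (suc g) i l)) below))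
          where
          e₀ : ∀ p g i l → p + g * l + i * l ≡ p + (i + g) * l
          e₀ = solve-∀
        e₁ : ∀ p t g l → p + t + g * l + l ≡ p + suc g * l + t
        e₁ = solve-∀
        e₂ : ∀ i r g v j m → i + r + g + (j + suc m) + suc v ≡ m + (suc (i + suc g) + (j + r + v))
        e₂ = solve-∀

      s-outside : ∀ {i a} → 2 ≤ i → i ≤ L → a ∈ A → a < l → s i % l ≢ a
      s-outside {i} {a} 2≤i i≤L a∈A a<l eq
        with e , a+el ← %-≡-≤⇒+k*l {a} {s i} (trans (m<n⇒m%n≡m a<l) (sym eq)) (subst (_≤ s i) eq (m%n≤m (s i) l))
        with r , t , t∈ , i+r , si+t , len≡ , sum≡ ← suffix as° i≤L
        with m≤n⇒m<n∨m≡n (quotient-< {as} as° {i} {a} {e} (<-≤-trans z<s 2≤i) i≤L a+el)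
      ... | inj₁ 1+e<i = x∉ (reach (e + u) (InSumset-suc a∈A t∈)
            (slack-≤ 0 (+-mono-≤ 1+e<i (≤-reflexive (trans (cong (_+ u) i+r) L+u))) (e₂ r e u i m))
            (trans (e₁ a t e u l) (trans (cong (λ z → z + t + u * l) a+el) (trans (cong (_+ u * l) si+t) S+ul))))
        where
        e₁ : ∀ a t e u l → a + t + (e + u) * l ≡ a + e * l + t + u * l
        e₁ = solve-∀
        e₂ : ∀ r e u i m → suc r + (e + u) + (i + suc m) + 0 ≡ m + (suc (suc e) + (i + r + u))
        e₂ = solve-∀
      -- No term is saved, but a and copies of l take the place of i ≥ 2 inner terms.
      ... | inj₂ refl = impossible n (a ∷ drop i as) bs (e + u) v ((a∈A , 0<a , a<l) ∷ All.drop⁺ i as°) bs°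
            (trans (cong (λ z → suc z + (e + u)) len≡) (trans (e₃ r e u) (trans (cong (_+ u) i+r) L+u)))
            (trans (cong (λ z → a + z + (e + u) * l) sum≡) (trans (e₁ a t e u l) (trans (cong (λ z → z + t + u * l) a+el) (trans (cong (_+ u * l) si+t) S+ul))))
            L′+v B≡
            (subst (λ z → suc z + L′ < n) (sym len≡)
              (slack-≤ 0 (+-mono-≤ 2≤i (subst (λ z → z + L′ ≤ n) (sym i+r) (≤-pred fuel))) (e₄ r L′ e n)))
        where
        0<a : 0 < a
        0<a = n≢0⇒n>0 λ { refl → s-distinct {0} {i} z<s i≤L (trans (m<n⇒m%n≡m (ℕ.>-nonZero⁻¹ l)) (sym eq)) }
        e₁ : ∀ a t e u l → a + t + (e + u) * l ≡ a + e * l + t + u * l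
        e₁ = solve-∀
        e₃ : ∀ r e u → suc r + (e + u) ≡ suc e + r + u
        e₃ = solve-∀
        e₄ : ∀ r L e n → suc (suc r + L) + (suc e + n) + 0 ≡ n + (2 + (suc e + r + L))
        e₄ = solve-∀

      b-outside : ∀ {j a} → 2 ≤ j → j ≤ L′ → a ∈ A → a < l → b j % l ≢ a
      b-outside {j} {a} 2≤j j≤L′ a∈A a<l eq
        with %-≡-≤⇒+k*l {a} {b j} (trans (m<n⇒m%n≡m a<l) (sym eq)) (subst (_≤ b j) eq (m%n≤m (b j) l)) | suffix bs° j≤L′
      ... | suc e , a+el | r , t , t∈ , j+r , bj+t , _ = x∉ (reach e (InSumset-suc a∈A t∈)
            (slack-≤ v (+-mono-≤ e<j (≤-reflexive (trans (cong (_+ v) j+r) L′+v))) (e₂ r e v j m))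
            (+-cancelʳ-≡ l _ _ (trans (e₁ a t e l) (trans (cong (_+ t) a+el) (trans bj+t B≡)))))
        where
        e<j : suc e < j
        e<j = quotient-< {bs} bs° {j} {a} {suc e} (<-≤-trans z<s 2≤j) j≤L′ a+el
        e₁ : ∀ a t e l → a + t + e * l + l ≡ a + suc e * l + t
        e₁ = solve-∀
        e₂ : ∀ r e v j m → suc r + e + (j + suc m) + v ≡ m + (suc (suc e) + (j + r + v))
        e₂ = solve-∀
      -- The prefix sums to a itself and has no l to give up. Replacing it by a and j zeros leaves
      -- fewer inner terms in the representation of x + l.
      b-outside {suc j} {a} 2≤j j≤L′ a∈A a<l eq | zero , a+el | r , t , t∈ , j+r , bj+t , len≡ , sum≡ =
        impossible n as (a ∷ drop (suc j) bs) u (j + v) as° ((a∈A , 0<a , a<l) ∷ All.drop⁺ (suc j) bs°)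
            L+u S+ul
            (trans (cong (λ z → suc z + (j + v)) len≡) (trans (e₃ r j v) (trans (cong (_+ v) j+r) L′+v)))
            (trans (cong (a +_) sum≡) (trans (cong (_+ t) (trans (sym (+-identityʳ a)) a+el)) (trans bj+t B≡)))
            (subst (λ z → L + suc z < n) (sym len≡)
              (slack-≤ 0 (+-mono-≤ 2≤j (subst (λ z → L + z ≤ n) (sym j+r) (≤-pred fuel))) (e₄ r L j n)))
        where
        0<a : 0 < a
        0<a = n≢0⇒n>0 λ { refl → b-distinct {0} {suc j} z<s j≤L′ (trans (m<n⇒m%n≡m (ℕ.>-nonZero⁻¹ l)) (sym eq)) }
        e₃ : ∀ r j v → suc r + (j + v) ≡ suc j + r + v
        e₃ = solve-∀
        e₄ : ∀ r L j n → suc (L + suc r) + (suc j + n) + 0 ≡ n + (2 + (L + (suc j + r)))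
        e₄ = solve-∀

      -- Exchanging the tails of as and bs after matching partial sums.
      low-match : ∀ {i j} → i ≤ L → j ≤ L′ → b j % l ≡ s i % l → b j ≤ s i → ∃ λ e → b j + e * l ≡ s i × i ≤ j + e
      low-match {i} {j} i≤L j≤L′ eq bj≤si
        with e , bj+el ← %-≡-≤⇒+k*l eq bj≤si
        with r , t , t∈ , i+r , si+t , _ ← suffix as° i≤L
        = e , bj+el , ≮⇒≥ λ j+e<i → x∉ (reach (e + u) (InSumset-+ (prefix bs° j≤L′) t∈)
            (slack-≤ 0 (+-mono-≤ j+e<i (≤-reflexive (trans (cong (_+ u) i+r) L+u))) (e₂ j r e u i m))
            (trans (e₁ (b j) t e u l) (trans (cong (λ z → z + t + u * l) bj+el) (trans (cong (_+ u * l) si+t) S+ul))))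
        where
        e₁ : ∀ p t g u l → p + t + (g + u) * l ≡ p + g * l + t + u * l
        e₁ = solve-∀
        e₂ : ∀ i r g u j m → i + r + (g + u) + (j + suc m) + 0 ≡ m + (suc (i + g) + (j + r + u))
        e₂ = solve-∀

      -- Two exchanges are excluded. The start of `as` with the end of `bs` gives j + v < i + e;
      -- after that, the start of `bs` with the end of `as`, paid for with e of the u copies of l,
      -- gives u < e.
      high-match : ∀ {i j} → i ≤ L → j ≤ L′ → b j % l ≡ s i % l → s i < b j →
        ∃ λ e → s i + e * l ≡ b j × u < e × j < i + e
      high-match {i} {j} i≤L j≤L′ eq si<bj
        with %-≡-≤⇒+k*l (sym eq) (<⇒≤ si<bj)
      ... | zero , si+el = contradiction (trans (sym (+-identityʳ _)) si+el) (<⇒≢ si<bj)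
      ... | suc e , si+el = suc e , si+el , ≰⇒> e≰u , j<i+e
        where
        j<i+e : j < i + suc e
        j<i+e with r , t , t∈ , j+r , bj+t , _ ← suffix bs° j≤L′ =
          ≤-<-trans (m≤m+n j v) (≰⇒> λ i+e≤j+v → x∉ (reach e (InSumset-+ (prefix as° i≤L) t∈)
            (slack-≤ 0 (+-mono-≤ i+e≤j+v (≤-reflexive (trans (cong (_+ v) j+r) L′+v))) (e₂ i r e v j m))
            (+-cancelʳ-≡ l _ _ (trans (e₁ (s i) t e l) (trans (cong (_+ t) si+el) (trans bj+t B≡))))))
          where
          e₁ : ∀ a t e l → a + t + e * l + l ≡ a + suc e * l + t
          e₁ = solve-∀
          e₂ : ∀ i r e v j m → i + r + e + (j + v + suc m) + 0 ≡ m + (i + suc e + (j + r + v))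
          e₂ = solve-∀
        e≰u : ¬ suc e ≤ u
        e≰u e≤u
          with d , e+d ← m≤n⇒∃[o]m+o≡n e≤u
          with r , t , t∈ , i+r , si+t , _ ← suffix as° i≤L
          = x∉ (reach d (InSumset-+ (prefix bs° j≤L′) t∈)
              (slack-≤ 0 (+-mono-≤ j<i+e (≤-reflexive (trans (cong₂ _+_ i+r e+d) L+u))) (e₂ j r d i e m))
              (trans (cong (λ z → z + t + d * l) (sym si+el)) (trans (e₁ (s i) e t d l)
                (trans (cong₂ (λ z w → z + w * l) si+t e+d) S+ul))))
          where
          e₁ : ∀ p e t d l → p + suc e * l + t + d * l ≡ p + t + (suc e + d) * l
          e₁ = solve-∀
          e₂ : ∀ j r d i e m → j + r + d + (i + suc e + suc m) + 0 ≡ m + (suc j + (i + r + (suc e + d)))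
          e₂ = solve-∀

      Low High : ℕ → Set
      Low  j = ∃ λ i → i < suc L × b j % l ≡ s i % l × b j ≤ s i
      High j = ∃ λ i → i < suc L × b j % l ≡ s i % l × s i < b j

      Low? : Decidable Low
      Low? j = anyUpTo? (λ i → (_ ℕ.≟ _) ×-dec (_ ℕ.≤? _)) (suc L)
      High? : Decidable High
      High? j = anyUpTo? (λ i → (_ ℕ.≟ _) ×-dec (_ ℕ.<? _)) (suc L)

      High-end : High L′
      High-end = L , ≤-refl , trans (cong (_% l) b≡) ([m+kn]%n≡m%n (s L) (suc u) l)
               , subst (s L <_) (sym b≡) (m<m+n (s L) (m≤n⇒m≤n+o (u * l) (ℕ.>-nonZero⁻¹ l)))
        where
        whole : ∀ xs → partial xs (length xs) ≡ sum xs
        whole xs = cong sum (take-all (length xs) xs ≤-refl)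
        e : ∀ S u l → S + u * l + l ≡ S + suc u * l
        e = solve-∀
        b≡ : b L′ ≡ s L + suc u * l
        b≡ = trans (whole bs) (trans B≡ (trans (cong (_+ l) (sym S+ul)) (trans (e (sum as) u l) (cong (_+ suc u * l) (sym (whole as))))))

      -- If i₁ ≤ i₀, the bounds on the two blocks contradict the two matchings. Otherwise s i₀ ≤ s
      -- i₁, so b rises by at least (e₀ + e₁) l between j₀ and j₁. Each term is below l, so this
      -- takes more than e₀ + e₁ terms, and e₁ > u.
      far-apart : ∀ {j₀ j₁} → j₀ < j₁ → j₁ ≤ L′ → Low j₀ → High j₁ → j₀ + suc (suc u) ≤ j₁
      far-apart {j₀} {j₁} j₀<j₁ j₁≤L′ (i₀ , s≤s i₀≤L , eq₀ , b≤s) (i₁ , s≤s i₁≤L , eq₁ , s<b)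
        with e₀ , low , i₀≤ ← low-match i₀≤L (≤-trans (<⇒≤ j₀<j₁) j₁≤L′) eq₀ b≤s
        with e₁ , high , u<e₁ , j₁< ← high-match i₁≤L j₁≤L′ eq₁ s<b
        with i₁ ℕ.≤? i₀
      ... | yes i₁≤i₀ = contradiction (*-cancelʳ-≤ (e₀ + e₁ + i₁ + j₀) (i₀ + j₁) l
              (slack-≤ 0 (+-mono-≤ (+-mono-≤ (proj₂ (block-≤ as° i₁≤i₀ i₀≤L)) (proj₂ (block-≤ bs° (<⇒≤ j₀<j₁) j₁≤L′)))
                                   (+-mono-≤ (≤-reflexive low) (≤-reflexive high)))
                (id₁ (b j₀) (b j₁) (s i₀) (s i₁) e₀ e₁ i₀ i₁ j₀ j₁ l)))
              (<⇒≱ (slack-≤ 0 (+-mono-≤ i₀≤ j₁<) (id₂ e₀ e₁ i₀ i₁ j₀ j₁)))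
        where
        id₁ : ∀ B B′ S S′ e e′ i i′ j j′ l →
          (e + e′ + i′ + j) * l + (S′ + i * l + (B + j′ * l) + (S + B′)) + 0
          ≡ (i + j′) * l + (S + i′ * l + (B′ + j * l) + (B + e * l + (S′ + e′ * l)))
        id₁ = solve-∀
        id₂ : ∀ e e′ i i′ j j′ → suc (i + j′) + (j + e + (i′ + e′)) + 0 ≡ e + e′ + i′ + j + (i + suc j′)
        id₂ = solve-∀
      ... | no i₁≰i₀ = ≤-trans (≤-trans (≤-reflexive (id₀ j₀ u)) (s≤s (+-monoʳ-≤ j₀ (≤-trans u<e₁ (m≤n+m e₁ e₀)))))
              (cancel-*l-< {j₀ + (e₀ + e₁)}
                (slack-≤ 0 (+-mono-≤ (+-mono-≤ (proj₁ (block-≤ as° (<⇒≤ (≰⇒> i₁≰i₀)) i₁≤L)) (proj₂ (block bs° j₀<j₁ j₁≤L′)))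
                                     (+-mono-≤ (≤-reflexive low) (≤-reflexive high)))
                  (id₁ (b j₀) (b j₁) (s i₀) (s i₁) e₀ e₁ j₀ j₁ l)))
        where
        id₀ : ∀ j u → j + suc (suc u) ≡ suc (j + suc u)
        id₀ = solve-∀
        id₁ : ∀ B B′ S S′ e e′ j j′ l →
          suc ((j + (e + e′)) * l) + (S′ + (B + j′ * l) + (S + B′)) + 0
          ≡ j′ * l + (S + suc (B′ + j * l) + (B + e * l + (S′ + e′ * l)))
        id₁ = solve-∀

      too-many : l < l
      too-many
        with j₀ , j₁ , j₀<j₁ , j₁≤L′ , lo , hi , unmatched ← low-high Low? High? L′ (0 , s≤s z≤n , refl , z≤n) (λ ()) High-end
        = begin-strict
        l                                  <⟨ count ⟩
        length residues                    ≤⟨ length-inj residues-unique id (∈-upTo⁺ ∘ small) (λ _ _ eq → eq) ⟩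
        length (upTo l)                    ≡⟨ length-upTo l ⟩
        l ∎
        where
        open ≤-Reasoning
        A⁻ : List ℕ
        A⁻ = filter (λ a → ¬? (a ℕ.≟ l)) A
        -- At least u + 1 indices lie strictly between j₀ and j₁. The first is skipped, since
        -- `b-outside` wants an index of at least 2 and j₀ may be 0.
        j : ℕ → ℕ
        j t = suc (suc t) + j₀
        -- The partial sums s 0 and s 1 are omitted, being 0 and an element of A. As L + u = m + 1,
        -- there are at least (n - 1) + m > l entries.
        residues : List ℕ
        residues = A⁻ ++ applyUpTo (λ t → s (suc (suc t)) % l) (L ∸ 1) ++ applyUpTo (λ t → b (j t) % l) u
        A⁻-∋ : ∀ {a} → a ∈ A⁻ → a ∈ A × a < l
        A⁻-∋ p = let q , a≢l = ∈-filter⁻ (λ a → ¬? (a ℕ.≟ l)) p in q , ≤∧≢⇒< (A≤l q) a≢l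
        i≤L : ∀ {t} → t < L ∸ 1 → suc (suc t) ≤ L
        i≤L {t} p = ≤-trans (s≤s p) (suc-pred-≤ p)
          where
          suc-pred-≤ : ∀ {k} → t < k ∸ 1 → suc (k ∸ 1) ≤ k
          suc-pred-≤ {suc k} _ = ≤-refl
        j<j₁ : ∀ {t} → t < u → j t < j₁
        j<j₁ {t} p = ≤-trans (≤-trans (≤-reflexive (e t j₀)) (+-monoʳ-≤ j₀ (s≤s (s≤s p)))) (far-apart j₀<j₁ j₁≤L′ lo hi)
          where
          e : ∀ t j → suc (suc (suc t) + j) ≡ j + suc (suc (suc t))
          e = solve-∀
        j≤L′ : ∀ {t} → t < u → j t ≤ L′
        j≤L′ p = ≤-trans (<⇒≤ (j<j₁ p)) j₁≤L′
        no-match : ∀ {i t} → i ≤ L → t < u → b (j t) % l ≢ s i % l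
        no-match {i} {t} i≤L p eq with unmatched {j t} (s≤s (m≤n+m j₀ (suc t))) (j<j₁ p) | b (j t) ℕ.≤? s i
        ... | ¬lo , ¬hi | yes q = ¬lo (i , s≤s i≤L , eq , q)
        ... | ¬lo , ¬hi | no ¬q = ¬hi (i , s≤s i≤L , eq , ≰⇒> ¬q)
        residues-unique : Unique residues
        residues-unique = ++⁺ (filter⁺ (λ a → ¬? (a ℕ.≟ l)) A-unique)
          (++⁺ (applyUpTo⁺₁ _ (L ∸ 1) (λ p q → s-distinct (s≤s (s≤s p)) (i≤L q)))
               (applyUpTo⁺₁ _ u (λ p q → b-distinct (+-monoˡ-< j₀ (s≤s (s≤s p))) (j≤L′ q)))
               λ (p , q) → let t , t< , eq = ∈-applyUpTo⁻ _ p ; t′ , t′< , eq′ = ∈-applyUpTo⁻ _ q in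
                 no-match (i≤L t<) t′< (trans (sym eq′) eq))
          λ (p , q) → let a∈A , a<l = A⁻-∋ p in case-⊎ a∈A a<l (∈-++⁻ (applyUpTo (λ t → s (suc (suc t)) % l) (L ∸ 1)) q)
          where
          case-⊎ : ∀ {a} → a ∈ A → a < l →
            a ∈ applyUpTo (λ t → s (suc (suc t)) % l) (L ∸ 1) ⊎ a ∈ applyUpTo (λ t → b (j t) % l) u → ⊥
          case-⊎ a∈A a<l (inj₁ q) = let t , t< , eq = ∈-applyUpTo⁻ _ q in
            s-outside (s≤s (s≤s z≤n)) (i≤L t<) a∈A a<l (sym eq)
          case-⊎ a∈A a<l (inj₂ q) = let t , t< , eq = ∈-applyUpTo⁻ _ q in
            b-outside (s≤s (s≤s z≤n)) (j≤L′ t<) a∈A a<l (sym eq)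
        small : ∀ {r} → r ∈ residues → r < l
        small p with ∈-++⁻ A⁻ p
        ... | inj₁ q = proj₂ (A⁻-∋ q)
        ... | inj₂ q with ∈-++⁻ (applyUpTo (λ t → s (suc (suc t)) % l) (L ∸ 1)) q
        ...   | inj₁ q′ = let _ , _ , eq = ∈-applyUpTo⁻ _ q′ in subst (_< l) (sym eq) (m%n<n _ l)
        ...   | inj₂ q′ = let _ , _ , eq = ∈-applyUpTo⁻ _ q′ in subst (_< l) (sym eq) (m%n<n _ l)
        length≡ : length residues ≡ length A⁻ + (L ∸ 1 + u)
        length≡ = trans (length-++ A⁻) (cong (length A⁻ +_) (trans (length-++ (applyUpTo _ (L ∸ 1)))
          (cong₂ _+_ (length-applyUpTo (λ t → s (suc (suc t)) % l) (L ∸ 1)) (length-applyUpTo (λ t → b (j t) % l) u))))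
        count : l < length residues
        count = subst (l <_) (sym length≡) (slack-≤ 0
          (+-mono-≤ (+-mono-≤ (length-remove l A-unique) (≤-trans (m≤n+m∸n (l + 2) (length A)) (+-monoʳ-≤ (length A) m≥))) m≤)
          (e l (length A) (length A⁻) (L ∸ 1) u m))
          where
          e : ∀ l n n′ k u m → suc l + (suc n′ + (n + m) + (k + u)) + 0 ≡ n′ + (k + u) + (n + (l + 2) + m)
          e = solve-∀
          m≤ : m ≤ L ∸ 1 + u
          m≤ = ≤-pred (≤-trans (≤-reflexive (sym L+u)) (+-monoˡ-≤ u (≤-suc-pred L)))
            where
            ≤-suc-pred : ∀ k → k ≤ suc (k ∸ 1)
            ≤-suc-pred zero = z≤n
            ≤-suc-pred (suc k) = ≤-refl

  step : ∀ {m x} → l + 2 ∸ length A ≤ m → x ∈[ suc m ]A → (x + l) ∈[ suc m ]A → x ∈[ m ]A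
  step {m} {x} m≥ (xs , len , xs⊆A , sum≡) (ys , len′ , ys⊆A , sum′≡)
    with strip xs xs⊆A | strip ys ys⊆A
  ... | as , u , suc w , as° , L , S | _ = reach u (as , refl , All.map proj₁ as° , refl)
        (≤-pred (≤-trans (s≤s (m≤m+n _ w)) (≤-reflexive (trans (sym (+-suc _ w)) (trans L len))))) (trans S sum≡)
  ... | _ | bs , suc v , w , bs° , L , S = reach v (bs , refl , All.map proj₁ bs° , refl)
        (≤-pred (≤-trans (≤-reflexive (sym (+-suc (length bs) v))) (≤-trans (m≤m+n _ w) (≤-reflexive (trans L len′)))))
        (+-cancelʳ-≡ l _ _ (trans (e (sum bs) v l) (trans S sum′≡)))
    where
    e : ∀ S v l → S + v * l + l ≡ S + suc v * l
    e = solve-∀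
  ... | as , u , zero , as° , L , S | bs , zero , v , bs° , L′ , S′ =
    decidable-stable (InSumset? m A x) λ x∉ → Representations.impossible x∉ m≥ (suc (length as + length bs)) as bs u v as° bs°
      (trans (sym (+-identityʳ _)) (trans L len)) (trans S sum≡)
      (trans (cong (_+ v) (sym (+-identityʳ (length bs)))) (trans L′ len′)) (trans (sym (+-identityʳ _)) (trans S′ sum′≡)) ≤-refl

  module _ {m x : ℕ} (m≥ : l + 2 ∸ length A ≤ m) where

    private
      F : ℕ → ℕ → Set
      F i j = (x + j * l) ∈[ m + i + j ]A

      F-i : ∀ i j → F i j → F (suc i) j
      F-i i j p = reach 0 p (≤-trans (≤-reflexive (+-identityʳ _)) (+-monoˡ-≤ j (+-monoʳ-≤ m (n≤1+n i)))) (+-identityʳ _)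

      F-j : ∀ i j → F i j → F i (suc j)
      F-j i j p = reach 1 p (≤-reflexive (e m i j)) (e′ x j l)
        where
        e : ∀ m i j → m + i + j + 1 ≡ m + i + suc j
        e = solve-∀
        e′ : ∀ x j l → x + j * l + 1 * l ≡ x + suc j * l
        e′ = solve-∀

      F-step : ∀ i j → F (suc i) j → F i (suc j) → F i j
      F-step i j p q = step (≤-trans m≥ (≤-trans (m≤m+n m i) (m≤m+n (m + i) j)))
        (subst (λ k → (x + j * l) ∈[ k ]A) (cong (_+ j) (+-suc m i)) p)
        (subst₂ (λ k y → y ∈[ k ]A) (+-suc (m + i) j) (e x j l) q)
        where
        e : ∀ x j l → x + suc j * l ≡ x + j * l + l
        e = solve-∀

      descend : ∀ i j → (∀ k → F (suc i) k) → F i j → F i 0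
      descend i zero p q = q
      descend i (suc j) p q = descend i j p (F-step i j (p j) q)

      raise-j : ∀ i → F i 0 → ∀ j → F i j
      raise-j i p zero = p
      raise-j i p (suc j) = F-j i j (raise-j i p j)

      raise-i : ∀ j → F 0 j → ∀ i → F i j
      raise-i j p zero = p
      raise-i j p (suc i) = F-i i j (raise-i j p i)

      -- F (i + 1) 0 spreads along its whole row, so F i j, inherited from F 0 j, descends to F i 0.
      corner : ∀ i j → F i 0 → F 0 j → F 0 0
      corner zero j p q = p
      corner (suc i) j p q = corner i j (descend i j (raise-j (suc i) p) (raise-i j q i)) q

    fill : ∀ {k q} → x ∈[ k ]A → (x + q * l) ∈[ m + q ]A → x ∈[ m ]A
    fill {k} {q} p p′ = subst₂ (λ k y → y ∈[ k ]A) (trans (+-identityʳ _) (+-identityʳ m)) (+-identityʳ x)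
      (corner k q (reach 0 p (≤-trans (≤-reflexive (+-identityʳ k)) (≤-trans (m≤n+m k m) (m≤m+n (m + k) 0))) refl)
        (subst (λ k → (x + q * l) ∈[ k ]A) (cong (_+ q) (sym (+-identityʳ m))) p′))

-- Gaps, Apéry elements and the reflection l - A

¬exc⇒¬¬rep : ∀ {B y} → ¬ InExc B y → ¬ ¬ Representable B y
¬exc⇒¬¬rep {y = zero} _ ¬rep = ¬rep ([] , [] , refl)
¬exc⇒¬¬rep {y = suc y} ¬exc ¬rep = ¬exc (z<s , ¬rep)

rep-+ : ∀ {B x y} → Representable B x → Representable B y → Representable B (x + y)
rep-+ (xs , xs⊆ , s) (ys , ys⊆ , s′) =
  let zs , _ , zs⊆ , t = InSumset-+ (xs , refl , xs⊆ , s) (ys , refl , ys⊆ , s′) in zs , zs⊆ , t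

-- Drop the zeros, then pad with zeros.
rep⇒sumset : ∀ {B x} → 0 ∈ B → Representable B x → InSumset x B x
rep⇒sumset {B} 0∈B (xs , xs⊆ , refl) = go xs xs⊆
  where
  one : ∀ y → y ∈ B → InSumset y B y
  one zero _ = [] , refl , [] , refl
  one (suc y) y∈ = subst (InSumset (suc y) B) (trans (cong (suc y +_) (*-zeroʳ y)) (+-identityʳ _))
    (InSumset-suc y∈ (InSumset-* 0∈B y))
  go : ∀ xs → All (_∈ B) xs → InSumset (sum xs) B (sum xs)
  go [] [] = [] , refl , [] , refl
  go (x ∷ xs) (x∈ ∷ xs⊆) = InSumset-+ (one x x∈) (go xs xs⊆)

rep? : ∀ {B} → 0 ∈ B → ∀ x → Dec (Representable B x)
rep? {B} 0∈B x = map′ (λ (xs , _ , xs⊆ , s) → xs , xs⊆ , s) (rep⇒sumset 0∈B) (InSumset? x B x)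

-- φ is max(E) + 1, a natural number in all cases: the convention max(∅) = -1 makes it 0, and then
-- `last` is vacuous.
record Conductor (B : List ℕ) (φ : ℕ) : Set where
  field
    beyond : ∀ {y} → φ ≤ y → ¬ InExc B y
    last   : ∀ {y} → φ ≡ suc y → InExc B y

conductor : ∀ {B e} → IsMaxExc B e → ∃ λ φ → Conductor B φ × e ≡ ℤ.+ φ ℤ.- ℤ.+ 1
conductor (inj₁ (none , refl)) = 0 , record { beyond = λ _ → none _ ; last = λ () } , refl
conductor (inj₂ (x , exc , refl , max)) = suc x
  , record { beyond = λ x<y exc′ → <⇒≱ x<y (max _ exc′) ; last = λ { refl → exc } } , refl

least : {P : ℕ → Set} → Decidable P → ∀ n → P n → ∃ λ z → P z × (∀ {y} → P y → z ≤ y)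
least P? n p with P? 0
... | yes p₀ = 0 , p₀ , λ _ → z≤n
least P? zero p | no ¬p₀ = contradiction p ¬p₀
least {P} P? (suc n) p | no ¬p₀ =
  let z , q , min = least (P? ∘ suc) n p in suc z , q , λ { {zero} r → contradiction r ¬p₀ ; {suc y} r → s≤s (min r) }

module _ (l : ℕ) .⦃ _ : NonZero l ⦄ where
  open Residues l

  record Apérys (B : List ℕ) : Set where
    field
      ap      : Fin l → ℕ
      cls-ap  : ∀ g → cls (ap g) ≡ g
      ap-rep  : ∀ g → Representable B (ap g)
      ap-min  : ∀ {z} → Representable B z → ap (cls z) ≤ z

    ap-⊞ : ∀ g h → ap (g ⊞ h) ≤ ap g + ap h
    ap-⊞ g h = subst (λ k → ap k ≤ ap g + ap h) (trans (cls-+ (ap g) (ap h)) (cong₂ _⊞_ (cls-ap g) (cls-ap h)))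
      (ap-min (rep-+ (ap-rep g) (ap-rep h)))

    gap : l ∈ B → ∀ {e} → InExc B e → e < ap (cls e)
    gap l∈B {e} (_ , ¬rep) = ≰⇒> λ ap≤ → let k , eq = %-≡-≤⇒+k*l (cls-cancel (cls-ap (cls e))) ap≤ in
      ¬rep (subst (Representable B) eq (rep-+ (ap-rep (cls e)) (let xs , _ , xs⊆ , s = InSumset-* l∈B k in xs , xs⊆ , s)))

  apérys : ∀ {B φ} → 0 ∈ B → Conductor B φ → Apérys B
  apérys {B} {φ} 0∈B cond = record
    { ap = λ g → proj₁ (least-in g)
    ; cls-ap = λ g → proj₁ (proj₁ (proj₂ (least-in g)))
    ; ap-rep = λ g → proj₂ (proj₁ (proj₂ (least-in g)))
    ; ap-min = λ {z} r → proj₂ (proj₂ (least-in (cls z))) (refl , r) }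
    where
    least-in : ∀ g → ∃ λ z → (cls z ≡ g × Representable B z) × (∀ {y} → cls y ≡ g × Representable B y → z ≤ y)
    -- The start toℕ g + φ l lies in the class g and beyond all gaps, so the class does meet the
    -- semigroup.
    least-in g = least (λ z → (cls z Fin.≟ g) ×-dec rep? 0∈B z) (toℕ g + φ * l)
      ( trans (cls-+k*l (toℕ g) φ) (cls-toℕ g)
      , decidable-stable (rep? 0∈B _) (¬exc⇒¬¬rep (Conductor.beyond cond (≤-trans (m≤m*n φ l) (m≤n+m _ (toℕ g))))))

reflect-sum : ∀ {A l} → (∀ {a} → a ∈ A → a ≤ l) → ∀ xs → All (_∈ A) xs → ∃ λ ys →
  length ys ≡ length xs × All (_∈ reflectSet l A) ys × sum xs + sum ys ≡ length xs * l
reflect-sum A≤l [] [] = [] , refl , [] , refl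
reflect-sum {A} {l} A≤l (x ∷ xs) (x∈ ∷ xs⊆) = let ys , len , ys⊆ , eq = reflect-sum A≤l xs xs⊆ in
  l ∸ x ∷ ys , cong suc len , ∈-map⁺ (l ∸_) x∈ ∷ ys⊆
  , trans (e x (sum xs) (l ∸ x) (sum ys)) (cong₂ _+_ (m+[n∸m]≡n (A≤l x∈)) eq)
  where
  e : ∀ a b c d → a + b + (c + d) ≡ a + c + (b + d)
  e = solve-∀

unreflect-sum : ∀ {A l} → (∀ {a} → a ∈ A → a ≤ l) → ∀ ys → All (_∈ reflectSet l A) ys →
  ∃ λ x → InSumset (length ys) A x × x + sum ys ≡ length ys * l
unreflect-sum A≤l [] [] = 0 , ([] , refl , [] , refl) , refl
unreflect-sum {A} {l} A≤l (y ∷ ys) (y∈ ∷ ys⊆) with unreflect-sum A≤l ys ys⊆ | ∈-map⁻ (l ∸_) y∈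
... | x , p , eq | a , a∈ , refl = a + x , InSumset-suc a∈ p , trans (e a x (l ∸ a) (sum ys)) (cong₂ _+_ (m+[n∸m]≡n (A≤l a∈)) eq)
  where
  e : ∀ a b c d → a + b + (c + d) ≡ a + c + (b + d)
  e = solve-∀

structure : ∀ {A} → Unique A → 0 ∈ A → ∀ l → .⦃ NonZero l ⦄ → l ∈ A → (∀ {a} → a ∈ A → a ≤ l) →
  ∀ m → l + 2 ∸ length A ≤ m → ∀ x → InSumset m A x ⇔
    (x ≤ m * l × ¬ InExc A x × ¬ (Σ ℕ λ e′ → InExc (reflectSet l A) e′ × x + e′ ≡ m * l))
structure {A} A-unique 0∈A l l∈A A≤l m m≥ x = mk⇔ to from
  where
  open Sumset A A-unique 0∈A l l∈A A≤l using (reach; fill)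
  to : _ → _
  to (xs , refl , xs⊆ , refl) = let ys , _ , ys⊆ , eq = reflect-sum A≤l xs xs⊆ in
      m+n≤o⇒m≤o (sum xs) (≤-reflexive eq)
    , (λ (_ , ¬rep) → ¬rep (xs , xs⊆ , refl))
    , (λ (e′ , (_ , ¬rep) , eq′) → ¬rep (ys , ys⊆ , +-cancelˡ-≡ (sum xs) _ _ (trans eq (sym eq′))))
  from : _ → InSumset m A x
  -- Not being exceptional gives representability only up to double negation, which decidability of
  -- m A removes.
  from (x≤ , ¬exc , ¬exc′) = decidable-stable (InSumset? m A x) λ x∉ →
    ¬exc⇒¬¬rep ¬exc λ (xs , xs⊆ , s) →
    ¬exc⇒¬¬rep (λ exc → ¬exc′ (m * l ∸ x , exc , m+[n∸m]≡n x≤)) λ (ys , ys⊆ , s′) →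
    let z , p , eq = unreflect-sum A≤l ys ys⊆ in
    -- Reflecting `ys` back turns m l - x into z with x + (length ys) l = z + m l, a sum of m +
    -- length ys elements of A.
    x∉ (fill m≥ (xs , refl , xs⊆ , s) (reach m p (≤-reflexive (+-comm (length ys) m)) (begin
      z + m * l                       ≡⟨ cong (z +_) (m+[n∸m]≡n x≤) ⟨
      z + (x + (m * l ∸ x))           ≡⟨ e z x (m * l ∸ x) ⟩
      x + (z + (m * l ∸ x))           ≡⟨ cong (λ w → x + (z + w)) s′ ⟨
      x + (z + sum ys)                ≡⟨ cong (x +_) eq ⟩
      x + length ys * l               ∎)))
    where
    open ≡-Reasoning
    e : ∀ a b c → a + (b + c) ≡ b + (a + c)
    e = solve-∀

conductor-sum : ∀ {A} → Unique A → 0 ∈ A → ∀ l → .⦃ NonZero l ⦄ → l ∈ A → (∀ {a} → a ∈ A → a ≤ l) →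
  ∀ {φ φ′} → Conductor A φ → Conductor (reflectSet l A) φ′ →
  ∀ ν k → suc (suc ν) ≤ length A → suc (k * ν) ≤ l → l ≤ suc k * ν →
  φ + φ′ + (k * suc k * ν + 2 * k) ≤ 2 * (k * l)
conductor-sum {A} A-unique 0∈A l l∈A A≤l {φ} {φ′} cond cond′ ν k ν≤ kν<l l≤ =
  conductors ν k φ φ′ (≤-pred (≤-trans ν≤ length-A≤)) kν<l l≤
    (λ eq → gap l∈A (Conductor.last cond eq)) (λ eq → gap′ l∈A′ (Conductor.last cond′ eq))
  where
  A′ = reflectSet l A
  0∈A′ : 0 ∈ A′
  0∈A′ = subst (_∈ A′) (n∸n≡0 l) (∈-map⁺ (l ∸_) l∈A)
  l∈A′ : l ∈ A′
  l∈A′ = ∈-map⁺ (l ∸_) 0∈A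
  open Apérys (apérys l 0∈A cond)
  open Apérys (apérys l 0∈A′ cond′) using () renaming (ap to ap′; ap-⊞ to ap′-⊞; gap to gap′; ap-min to ap′-min)
  open Apéry l A A-unique 0∈A l∈A A≤l
  open Subset
  open import Algebra.Properties.Group (AbelianGroup.group ⊞-abelianGroup) using (inverseʳ-unique)
  single : ∀ {B b} → b ∈ B → Representable B b
  single b∈ = _ ∷ [] , b∈ ∷ [] , +-identityʳ _
  cls-reflect : ∀ {a} → a ∈ A → cls (l ∸ a) ≡ ⊟ cls a
  cls-reflect {a} a∈ = inverseʳ-unique (cls a) (cls (l ∸ a))
    (trans (sym (cls-+ a (l ∸ a))) (trans (cong cls (m+[n∸m]≡n (A≤l a∈))) cls-l))
  generates : ∀ U → U ∋ cls 0 → (∀ {g a} → a ∈ A → U ∋ g → U ∋ g ⊞ cls a) → ∀ g → U ∋ g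
  generates U 0∈U closed g = subst (U ∋_) (cls-ap g) (let xs , xs⊆ , s = ap-rep g in
      subst (λ z → U ∋ cls z) s (go xs xs⊆))
    where
    go : ∀ xs → All (_∈ A) xs → U ∋ cls (sum xs)
    go [] [] = 0∈U
    go (x ∷ xs) (x∈ ∷ xs⊆) = subst (U ∋_) (trans (IsAbelianGroup.comm isAbelianGroup _ _) (sym (cls-+ x (sum xs)))) (closed x∈ (go xs xs⊆))
  ap-A : ∀ {a} → a ∈ A → ap (cls a) ≤ a
  ap-A a∈ = ap-min (single a∈)
  ap′-A : ∀ {a} → a ∈ A → ap′ (⊟ cls a) ≤ l ∸ a
  ap′-A {a} a∈ = subst (λ g → ap′ g ≤ l ∸ a) (cls-reflect a∈) (ap′-min (single (∈-map⁺ (l ∸_) a∈)))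
  open Bounds ap ap′ cls-ap ap-⊞ ap′-⊞ ap-A ap′-A generates

-- The constant Δ and the inequalities between integers

excess : ℕ → ℕ → ℕ → ℕ → ℕ
excess l n k r = l * (k ∸ 1) * (n ∸ 3) + r * k * (n ∸ 3) + r * r + k + 1

2≤excess : ∀ l n {k} r → 1 ≤ k → 2 ≤ excess l n k r
2≤excess l n {k} r 1≤k = subst (2 ≤_) (sym (+-assoc (a + r * r) k 1))
  (≤-trans (+-monoˡ-≤ 1 1≤k) (m≤n+m (k + 1) (a + r * r)))
  where a = l * (k ∸ 1) * (n ∸ 3) + r * k * (n ∸ 3)

-- With l = k (n - 2) + r + 1, the bound on the conductors is exactly the one in terms of Δ.
sum-excess : ∀ p k r Φ → let l = suc (suc k * suc p + r) in
  Φ + (suc k * suc (suc k) * suc p + 2 * suc k) ≤ 2 * (suc k * l) →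
  (p + 2) * l + excess l (3 + p) (suc k) r + Φ ≤ l * l + 2
sum-excess p k r Φ h = slack-≤ 0 h (e p k r Φ)
  where
  e : ∀ p k r Φ → let l = suc (suc k * suc p + r) in
    (p + 2) * l + (l * k * p + r * suc k * p + r * r + suc k + 1) + Φ + 2 * (suc k * l) + 0
    ≡ l * l + 2 + (Φ + (suc k * suc (suc k) * suc p + 2 * suc k))
  e = solve-∀

cast-excess : ∀ m l φ φ′ k r {p n} → 3 + p ≡ n →
  (l ≡ suc (k * suc p + r) → 1 ≤ k → r ≤ p → (p + 2) * l + excess l (3 + p) k r + (φ + φ′) ≤ l * l + 2) →
  l ≡ suc (k * (n ∸ 2) + r) → 1 ≤ k → r ≤ n ∸ 3 →
  (ℤ.+ m ℤ.- (ℤ.+ l ℤ.- ℤ.+ n ℤ.+ ℤ.+ 2) ℤ.+ ℤ.+ 1) ℤ.* ℤ.+ l ℤ.+ ℤ.+ excess l n k r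
  ℤ.≤ (ℤ.+ (m * l) ℤ.- (ℤ.+ φ′ ℤ.- ℤ.+ 1)) ℤ.- (ℤ.+ φ ℤ.- ℤ.+ 1)
cast-excess m l φ φ′ k r {p} refl h l≡ 1≤k r≤ = subst₂ ℤ._≤_ left right (ℤ.+-monoˡ-≤ c (ℤ.+≤+ (h l≡ 1≤k r≤)))
  where
  Δ : ℕ
  Δ = excess l (3 + p) k r
  M L P D F F′ c : ℤ
  M = ℤ.+ m
  L = ℤ.+ l
  P = ℤ.+ p
  D = ℤ.+ Δ
  F = ℤ.+ φ
  F′ = ℤ.+ φ′
  -- Adding c to both sides turns the inequality between naturals into the one with differences.
  c = M ℤ.* L ℤ.- (F ℤ.+ F′) ℤ.- L ℤ.* L
  eₗ : ∀ M L P D F F′ → ((P ℤ.+ ℤ.+ 2) ℤ.* L ℤ.+ D ℤ.+ (F ℤ.+ F′)) ℤ.+ (M ℤ.* L ℤ.- (F ℤ.+ F′) ℤ.- L ℤ.* L)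
    ≡ (M ℤ.- (L ℤ.- (ℤ.+ 3 ℤ.+ P) ℤ.+ ℤ.+ 2) ℤ.+ ℤ.+ 1) ℤ.* L ℤ.+ D
  eₗ = ℤSolver.solve-∀
  eᵣ : ∀ M L F F′ → (L ℤ.* L ℤ.+ ℤ.+ 2) ℤ.+ (M ℤ.* L ℤ.- (F ℤ.+ F′) ℤ.- L ℤ.* L)
    ≡ (M ℤ.* L ℤ.- (F′ ℤ.- ℤ.+ 1)) ℤ.- (F ℤ.- ℤ.+ 1)
  eᵣ = ℤSolver.solve-∀
  left : ℤ.+ ((p + 2) * l + Δ + (φ + φ′)) ℤ.+ c
    ≡ (M ℤ.- (L ℤ.- ℤ.+ (3 + p) ℤ.+ ℤ.+ 2) ℤ.+ ℤ.+ 1) ℤ.* L ℤ.+ D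
  left = trans (cong (λ z → (z ℤ.+ D ℤ.+ (F ℤ.+ F′)) ℤ.+ c) (ℤ.pos-* (p + 2) l)) (eₗ M L P D F F′)
  right : ℤ.+ (l * l + 2) ℤ.+ c ≡ (ℤ.+ (m * l) ℤ.- (F′ ℤ.- ℤ.+ 1)) ℤ.- (F ℤ.- ℤ.+ 1)
  right = trans (cong (λ z → (z ℤ.+ ℤ.+ 2) ℤ.+ c) (ℤ.pos-* l l))
    (trans (eᵣ M L F F′) (cong (λ z → (z ℤ.- (F′ ℤ.- ℤ.+ 1)) ℤ.- (F ℤ.- ℤ.+ 1)) (sym (ℤ.pos-* m l))))

-- Since Δ ≥ 2, the hypothesis leaves Φ ≤ (l - p - 2) l, and this factor is less than m.
disjoint-ends : ∀ {m l p Δ Φ} → (p + 2) * l + Δ + Φ ≤ l * l + 2 → 2 ≤ Δ → l ≤ m + suc p → Φ ≤ m * l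
disjoint-ends {m} {l} {p} {Δ} {Φ} h 2≤Δ l≤ = slack-≤ l (+-mono-≤ (+-mono-≤ h 2≤Δ) (*-monoˡ-≤ l l≤)) (e m l p Δ Φ)
  where
  e : ∀ m l p Δ Φ → Φ + (l * l + 2 + Δ + (m + suc p) * l) + l ≡ m * l + ((p + 2) * l + Δ + Φ + 2 + l * l)
  e = solve-∀

pred-suc : ∀ φ → ℤ.+ φ ℤ.- ℤ.+ 1 ℤ.+ ℤ.+ 1 ≡ ℤ.+ φ
pred-suc φ = e (ℤ.+ φ)
  where
  e : ∀ F → F ℤ.- ℤ.+ 1 ℤ.+ ℤ.+ 1 ≡ F
  e = ℤSolver.solve-∀

minus-pred : ∀ a φ → (ℤ.+ a ℤ.- (ℤ.+ φ ℤ.- ℤ.+ 1)) ℤ.- ℤ.+ 1 ≡ ℤ.+ a ℤ.- ℤ.+ φ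
minus-pred a φ = e (ℤ.+ a) (ℤ.+ φ)
  where
  e : ∀ a F → (a ℤ.- (F ℤ.- ℤ.+ 1)) ℤ.- ℤ.+ 1 ≡ a ℤ.- F
  e = ℤSolver.solve-∀

≤-minus : ∀ {x φ a} → x + φ ≤ a → ℤ.+ x ℤ.≤ ℤ.+ a ℤ.- ℤ.+ φ
≤-minus {x} {φ} {a} h = subst (ℤ._≤ ℤ.+ a ℤ.- ℤ.+ φ) (e (ℤ.+ x) (ℤ.+ φ)) (ℤ.+-monoˡ-≤ (ℤ.- ℤ.+ φ) (ℤ.+≤+ h))
  where
  e : ∀ x F → (x ℤ.+ F) ℤ.- F ≡ x
  e = ℤSolver.solve-∀

minus-≤ : ∀ {x φ a} → ℤ.+ x ℤ.≤ ℤ.+ a ℤ.- ℤ.+ φ → x + φ ≤ a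
minus-≤ {x} {φ} {a} h = ℤ.drop‿+≤+ (subst (ℤ.+ (x + φ) ℤ.≤_) (e (ℤ.+ a) (ℤ.+ φ)) (ℤ.+-monoˡ-≤ (ℤ.+ φ) h))
  where
  e : ∀ a F → (a ℤ.- F) ℤ.+ F ≡ a
  e = ℤSolver.solve-∀

block-bounds : ∀ {A} → Unique A → 0 ∈ A → ∀ l → .⦃ NonZero l ⦄ → l ∈ A → (∀ {a} → a ∈ A → a ≤ l) →
  ∀ p → length A ≡ 3 + p → ∀ m → l + 2 ∸ length A ≤ m →
  ∀ {φ φ′} → Conductor A φ → Conductor (reflectSet l A) φ′ →
  φ + φ′ ≤ m * l × (∀ {x} → φ ≤ x → x + φ′ ≤ m * l → InSumset m A x) ×
  (∀ k r → l ≡ suc (k * suc p + r) → 1 ≤ k → r ≤ p → (p + 2) * l + excess l (3 + p) k r + (φ + φ′) ≤ l * l + 2)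
block-bounds {A} A-unique 0∈A l l∈A A≤l p n≡ m m≥ {φ} {φ′} cond cond′ = ends , inside , sharp
  where
  sharp : ∀ k r → l ≡ suc (k * suc p + r) → 1 ≤ k → r ≤ p → (p + 2) * l + excess l (3 + p) k r + (φ + φ′) ≤ l * l + 2
  sharp (suc k) r refl 1≤k r≤p = sum-excess p k r (φ + φ′)
    (conductor-sum A-unique 0∈A l l∈A A≤l cond cond′ (suc p) (suc k) (≤-reflexive (sym n≡))
      (s≤s (m≤m+n _ r)) (≤-trans (≤-reflexive (sym (+-suc _ r))) (≤-trans (+-monoʳ-≤ (suc k * suc p) (s≤s r≤p))
        (≤-reflexive (+-comm (suc k * suc p) (suc p))))))
  n≤1+l : 3 + p ≤ suc l
  n≤1+l = subst₂ _≤_ n≡ (length-upTo (suc l)) (length-inj A-unique id (λ a∈ → ∈-upTo⁺ (s≤s (A≤l a∈))) (λ _ _ eq → eq))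
  -- Nonemptiness is asserted without reference to k and r; division of l - 1 by n - 2 supplies
  -- them.
  q k r : ℕ
  q = l ∸ 1
  k = q / suc p
  r = q % suc p
  l≡ : l ≡ suc (k * suc p + r)
  l≡ = trans (sym (m+[n∸m]≡n {1} (≤-trans (s≤s z≤n) (≤-pred n≤1+l)))) (cong suc (trans (m≡m%n+[m/n]*n q (suc p)) (+-comm r _)))
  1≤k : 1 ≤ k
  1≤k = m≥n⇒m/n>0 (∸-monoˡ-≤ 1 (≤-pred n≤1+l))
  ends : φ + φ′ ≤ m * l
  ends = disjoint-ends {m} {l} {p} {excess l (3 + p) k r} (sharp k r l≡ 1≤k (≤-pred (m%n<n q (suc p)))) (2≤excess l (3 + p) r 1≤k)
    (slack-≤ 0 (≤-trans (m≤n+m∸n (l + 2) (length A)) (+-mono-≤ (≤-reflexive n≡) m≥)) (e l m p))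
    where
    e : ∀ l m p → l + (3 + p + m) + 0 ≡ m + suc p + (l + 2)
    e = solve-∀
  inside : ∀ {x} → φ ≤ x → x + φ′ ≤ m * l → InSumset m A x
  inside {x} φ≤x x≤ = Equivalence.from (structure A-unique 0∈A l l∈A A≤l m m≥ x)
    ( m+n≤o⇒m≤o x x≤ , Conductor.beyond cond φ≤x
    , λ (y , exc , eq) → Conductor.beyond cond′ (+-cancelˡ-≤ x _ _ (≤-trans x≤ (≤-reflexive (sym eq)))) exc )

theorem3 : (A : List ℕ) → Unique A → 3 ≤ length A
    → 0 ∈ A → gcdList A ≡ 1
    → (l : ℕ) → l ∈ A → All (_≤ l) A
    → (m : ℕ) → l + 2 ∸ length A ≤ m
    → ((x : ℕ) → InSumset m A x ⇔
    (x ≤ m * l × ¬ InExc A x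
    × ¬ (Σ ℕ λ e′ → InExc (reflectSet l A) e′ × x + e′ ≡ m * l)))
    × ((e e′ : ℤ) → IsMaxExc A e → IsMaxExc (reflectSet l A) e′
    → (e ℤ.+ ℤ.+ 1 ℤ.≤ (ℤ.+ (m * l) ℤ.- e′) ℤ.- ℤ.+ 1)
    × ((x : ℕ) → e ℤ.+ ℤ.+ 1 ℤ.≤ ℤ.+ x
    → ℤ.+ x ℤ.≤ (ℤ.+ (m * l) ℤ.- e′) ℤ.- ℤ.+ 1 → InSumset m A x)
    × ((k r : ℕ) → l ≡ suc (k * (length A ∸ 2) + r) → 1 ≤ k
    → r ≤ length A ∸ 3
    → ((ℤ.+ m ℤ.- (ℤ.+ l ℤ.- ℤ.+ length A ℤ.+ ℤ.+ 2) ℤ.+ ℤ.+ 1) ℤ.* ℤ.+ l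
    ℤ.+ ℤ.+ (l * (k ∸ 1) * (length A ∸ 3) + r * k * (length A ∸ 3)
    + r * r + k + 1)
    ℤ.≤ (ℤ.+ (m * l) ℤ.- e′) ℤ.- e)
    × 2 ≤ l * (k ∸ 1) * (length A ∸ 3) + r * k * (length A ∸ 3)
    + r * r + k + 1))
theorem3 A A-unique 3≤n 0∈A _ l l∈A A≤l m m≥ with m≤n⇒∃[o]m+o≡n 3≤n
... | p , n≡ = structure A-unique 0∈A l l∈A (All.lookup A≤l) m m≥ , bounds
  where
  instance
    l≢0 : NonZero l
    l≢0 = ℕ.>-nonZero (≤-pred (≤-trans (≤-trans (s≤s (s≤s z≤n)) 3≤n)
      (subst (length A ≤_) (length-upTo (suc l))
        (length-inj A-unique id (λ a∈ → ∈-upTo⁺ (s≤s (All.lookup A≤l a∈))) (λ _ _ eq → eq)))))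
  bounds : (e e′ : ℤ) → IsMaxExc A e → IsMaxExc (reflectSet l A) e′ → _
  bounds e e′ max max′
    with φ , cond , refl ← conductor max | φ′ , cond′ , refl ← conductor max′
    with ends , inside , sharp ← block-bounds A-unique 0∈A l l∈A (All.lookup A≤l) p (sym n≡) m m≥ cond cond′
    = subst₂ ℤ._≤_ (sym (pred-suc φ)) (sym (minus-pred (m * l) φ′)) (≤-minus ends)
    , (λ x φ≤x x≤ → inside (ℤ.drop‿+≤+ (subst (ℤ._≤ ℤ.+ x) (pred-suc φ) φ≤x))
                           (minus-≤ (subst (ℤ.+ x ℤ.≤_) (minus-pred (m * l) φ′) x≤)))
    , λ k r l≡ 1≤k r≤ → cast-excess m l φ φ′ k r n≡ (sharp k r) l≡ 1≤k r≤ , 2≤excess l (length A) r 1≤k
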